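{- Let $G$ be a (finite, simple) plane graph with minimum degree five. Then $G$ contains at least one of the following minor $5$-stars: $\langle 5,5,5,7,17\rangle$, $\langle 7,5,5,7,11\rangle$, $\langle 7,5,5,8,9\rangle$, $\langle 7,5,5,9,8\rangle$, $\langle 7,5,5,11,7\rangle$, $\langle 5,5,5,8,11\rangle$, $\langle 8,5,5,9,7\rangle$, $\langle 8,5,5,11,6\rangle$, $\langle 6,6,6,6,11\rangle$, $\langle 6,6,6,7,9\rangle$, $\langle 6,6,7,6,9\rangle$, $\langle 6,6,7,7,7\rangle$, $\langle 6,7,6,7,7\rangle$, $\langle 5,6,6,8,9\rangle$, $\langle 5,6,8,6,9\rangle$, $\langle 5,6,7,7,9\rangle$, $\langle 5,6,6,7,11\rangle$, $\langle 5,6,7,6,11\rangle$, $\langle 5,7,6,7,9\rangle$, $\langle 5,7,7,6,9\rangle$, $\langle 5,6,6,6,17\rangle$, $\langle 5,7,6,6,11\rangle$, $\langle 5,8,6,6,10\rangle$, $\langle 5,9,6,6,9\rangle$, $\langle 5,5,9,6,9\rangle$, $\langle 5,6,6,5,\infty\rangle$, $\langle 5,6,7,5,23\rangle$, $\langle 5,6,8,5,15\rangle$, $\langle 5,6,9,5,14\rangle$, $\langle 5,9,5,6,10\rangle$, $\langle 5,8,5,6,11\rangle$, $\langle 5,7,5,6,17\rangle$, $\langle 5,7,7,5,11\rangle$, $\langle 5,7,8,5,9\rangle$, $\langle 5,8,5,7,9\rangle$, $\langle 5,7,5,7,11\rangle$, $\langle 5,7,5,8,10\rangle$, $\langle 5,7,5,9,9\rangle$,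 $\langle 5,5,10,5,14\rangle$, $\langle 5,5,11,5,13\rangle$.
   Context: A plane graph is a graph embedded in the plane without edge crossings; $\deg(v)$ denotes the degree of $v$ in $G$. For integers (or $\infty$) $\kappa_1,\dots,\kappa_5$, a $\langle \kappa_1,\kappa_2,\kappa_3,\kappa_4,\kappa_5\rangle$-star in $G$ is a vertex $v$ of degree exactly $5$ together with its five neighbors $v_1,\dots,v_5$, listed in the cyclic order around $v$ given by the embedding (starting at some neighbor, in either orientation), such that $\deg(v_i)\le \kappa_i$ for $i=1,\dots,5$; the entry $\infty$ means no restriction. A minor $5$-star is a $5$-vertex together with its five neighbors. -}

module Defs where

-- Plane graphs are encoded combinatorially as rotation systems (combinatorial
-- maps): a finite set of darts (half-edges) Fin n, a permutation σ giving the
-- cyclic (clockwise) order of darts around each vertex, and a fixed-point-free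
-- involution α pairing the two darts of each edge.  Vertices = σ-orbits,
-- edges = α-orbits, faces = orbits of σ ∘ α.  By the Heffter–Edmonds–Ringel
-- theorem, rotation systems with Euler characteristic 2 on every connected
-- component are exactly (up to equivalence) the plane embeddings, and σ
-- records the cyclic order of neighbours around each vertex in the embedding.

open import Data.Nat using (ℕ; zero; suc; _+_; _*_; _≤_; _≤?_; _<_)
open import Data.Fin using (Fin; zero; suc; toℕ; _≟_)
open import Data.Fin.Permutation using (Permutation′; _⟨$⟩ʳ_; _⟨$⟩ˡ_)
open import Data.Bool using (Bool; true; false; _∧_; _∨_; not; if_then_else_)
open import Data.Maybe using (Maybe; just; nothing)
open import Data.Unit using (⊤)
open import Data.Product using (Σ; _×_)
open import Data.Sum using (_⊎_)
open import Data.Vec using (Vec; lookup)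
open import Relation.Nullary.Decidable using (⌊_⌋)
open import Relation.Binary.PropositionalEquality using (_≡_; _≢_)

iter : {A : Set} → (A → A) → ℕ → A → A
iter f zero    x = x
iter f (suc k) x = f (iter f k x)

anyFin : ∀ {n} → (Fin n → Bool) → Bool
anyFin {zero}  p = false
anyFin {suc n} p = p zero ∨ anyFin (λ i → p (suc i))

allFin : ∀ {n} → (Fin n → Bool) → Bool
allFin {zero}  p = true
allFin {suc n} p = p zero ∧ allFin (λ i → p (suc i))

countFin : ∀ {n} → (Fin n → Bool) → ℕ
countFin {zero}  p = 0
countFin {suc n} p = (if p zero then 1 else 0) + countFin (λ i → p (suc i))

_==_ : ∀ {n} → Fin n → Fin n → Bool
d == e = ⌊ d ≟ e ⌋

-- e lies in the orbit of d under the permutation f of Fin n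
-- (orbits have length ≤ n, so exponents k < n suffice)
inOrbit : ∀ {n} → (Fin n → Fin n) → Fin n → Fin n → Bool
inOrbit {n} f d e = anyFin {n} (λ k → iter f (toℕ k) d == e)

isOrbitRep : ∀ {n} → (Fin n → Fin n) → Fin n → Bool
isOrbitRep {n} f d = allFin {n} (λ k → ⌊ toℕ d ≤? toℕ (iter f (toℕ k) d) ⌋)

numOrbits : ∀ {n} → (Fin n → Fin n) → ℕ
numOrbits f = countFin (isOrbitRep f)

record RotationSystem : Set where
  field
    n     : ℕ
    σ     : Permutation′ n
    α     : Permutation′ n
    α-invol : ∀ d → α ⟨$⟩ʳ (α ⟨$⟩ʳ d) ≡ d
    α-fpf   : ∀ d → α ⟨$⟩ʳ d ≢ d

module _ (M : RotationSystem) where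
  open RotationSystem M

  Dart : Set
  Dart = Fin n

  rot : Dart → Dart
  rot d = σ ⟨$⟩ʳ d

  rot⁻¹ : Dart → Dart
  rot⁻¹ d = σ ⟨$⟩ˡ d

  opp : Dart → Dart
  opp d = α ⟨$⟩ʳ d

  φ : Dart → Dart
  φ d = rot (opp d)

  sameVertex : Dart → Dart → Bool
  sameVertex = inOrbit rot

  deg : Dart → ℕ
  deg d = countFin (sameVertex d)

  reach : Dart → ℕ → Dart → Bool
  reach d zero    e = d == e
  reach d (suc k) e = reach d k e ∨ anyFin (λ x → reach d k x ∧ (rot x == e ∨ opp x == e))

  isComponentRep : Dart → Bool
  isComponentRep d = allFin (λ e → not (reach d n e) ∨ ⌊ toℕ d ≤? toℕ e ⌋)

  numVertices numFaces numComponents : ℕ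
  numVertices   = numOrbits rot
  numFaces      = numOrbits φ
  numComponents = countFin isComponentRep

  -- Euler's formula V - E + F = 2c (E = n/2), i.e. genus 0 on every component
  IsPlane : Set
  IsPlane = 2 * numVertices + 2 * numFaces ≡ n + 4 * numComponents

  IsSimple : Set
  IsSimple = (∀ d → sameVertex d (opp d) ≡ false)
           × (∀ d e → sameVertex d e ≡ true → d ≢ e → sameVertex (opp d) (opp e) ≡ false)

  MinDegreeFive : Set
  MinDegreeFive = ∀ d → 5 ≤ deg d

data Bound : Set where
  fin : ℕ → Bound
  ∞   : Bound

_≤ᴮ_ : ℕ → Bound → Set
k ≤ᴮ fin m = k ≤ m
k ≤ᴮ ∞     = ⊤

-- ⟨κ₁,…,κ₅⟩-star: a 5-vertex v (the start of dart d) whose neighbours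
-- v₁,…,v₅, in the cyclic order around v (either orientation, starting at
-- any neighbour, i.e. any dart d at v) satisfy deg vᵢ ≤ κᵢ.
-- The i-th neighbour is the endpoint of dart rotⁱ d (resp. rot⁻ⁱ d).
HasStar : (M : RotationSystem) → Vec Bound 5 → Set
HasStar M κ = Σ (Dart M) λ d → deg M d ≡ 5 ×
  ( (∀ (i : Fin 5) → deg M (opp M (iter (rot M) (toℕ i) d)) ≤ᴮ lookup κ i)
  ⊎ (∀ (i : Fin 5) → deg M (opp M (iter (rot⁻¹ M) (toℕ i) d)) ≤ᴮ lookup κ i))

{-# OPTIONS --safe #-}
module Submission where

-- Euler's formula gives Σ (deg v - 6) + Σ (2|f| - 6) < 0, so no redistribution of these charges over vertices
-- and faces can leave them all nonnegative.  A face that is not a triangle gives 1/2 to each of its corners.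
-- A vertex of degree k ≥ 8 sends (about) (k - 6)/k along each dart, and the part that goes towards a neighbour of
-- degree at least 6 is divided between the two neighbouring darts; a 7-vertex sends 1/4 to each 5-neighbour
-- that is next to a neighbour of larger degree.  The only 5-vertices v that may still be short of charge are
-- those whose neighbours have degrees k,5,K,5,5 in cyclic order, with k ≤ 9 and K ≥ 15.  Call the last two
-- neighbours y and e, and let w be the third vertex of the other face at the edge ye: if w has degree at least
-- 12 then y can pay the difference, and otherwise the absence of forbidden stars around e makes e rich enough.
-- That every 5-vertex ends nonnegative is a statement about five degrees, decided by computation.
--
-- The graph is not triangulated beforehand: at a face that is not a triangle the bonus of 1/2
-- outweighs the charge that is not passed on through it.

open import Defs
open import Data.Bool using (Bool; true; false; _∧_; _∨_; not; if_then_else_; T)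
import Data.Bool.Properties as Bool
open import Data.Fin using (Fin; zero; suc; toℕ; fromℕ<; _≟_)
open import Data.Fin.Permutation using (inverseˡ; inverseʳ; flip)
import Data.Fin.Properties as Fin
open import Data.List using (List; []; _∷_; _++_; concatMap; filterᵇ)
open import Data.List.Relation.Unary.All as All using (All; []; _∷_)
import Data.List.Relation.Unary.All.Properties as All
open import Data.List.Relation.Unary.Any using (Any; any?)
open import Data.Maybe as Maybe using (Maybe; just; nothing)
open import Data.Nat using (ℕ; zero; suc; _+_; _*_; _∸_; _≤_; _<_; _≤?_; _≤ᵇ_; _≡ᵇ_; z≤n; s≤s)
open import Data.Nat.Properties renaming (_≟_ to _≟ℕ_)
open import Data.Nat.Solver using (module +-*-Solver)
open import Data.Product as Product using (∃; _×_; _,_; proj₁; proj₂)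
open import Data.Sum using (inj₁; inj₂)
open import Data.Unit using (tt)
open import Data.Vec using (Vec; []; _∷_; _[_]≔_; lookup; map; replicate)
open import Data.Vec.Relation.Binary.Pointwise.Inductive using (Pointwise; []; _∷_)
open import Function using (_∘_)
open import Relation.Binary.Definitions using (tri<; tri≈; tri>)
open import Relation.Binary.PropositionalEquality
open import Relation.Nullary using (¬_; Dec; yes; no; contradiction)
open import Relation.Nullary.Decidable using (⌊_⌋; dec-true; isYes≗does; _×-dec_; _⊎-dec_; decidable-stable)
open import Algebra.Properties.CommutativeMonoid.Sum +-0-commutativeMonoid
  using (sum; sum-cong-≗; ∑-distrib-+; ∑-comm; sum-permute)

-- Sums over the orbits of a permutation

infixl 8 _when_
_when_ : ℕ → Bool → ℕ
x when b = if b then x else 0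

sum-mono : ∀ {n} {f g : Fin n → ℕ} → (∀ i → f i ≤ g i) → sum f ≤ sum g
sum-mono {zero}  f≤g = z≤n
sum-mono {suc n} f≤g = +-mono-≤ (f≤g zero) (sum-mono (f≤g ∘ suc))

sum-zero : ∀ {n} → sum {n} (λ _ → 0) ≡ 0
sum-zero {zero}  = refl
sum-zero {suc n} = sum-zero {n}

sum-const : ∀ n c → sum {n} (λ _ → c) ≡ n * c
sum-const zero    c = refl
sum-const (suc n) c = cong (c +_) (sum-const n c)

sum-*ʳ : ∀ {n} (f : Fin n → ℕ) c → sum f * c ≡ sum (λ i → f i * c)
sum-*ʳ {zero}  f c = refl
sum-*ʳ {suc n} f c = trans (*-distribʳ-+ c (f zero) _) (cong (f zero * c +_) (sum-*ʳ (f ∘ suc) c))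

countFin≡sum : ∀ {n} (p : Fin n → Bool) → countFin p ≡ sum (λ i → 1 when p i)
countFin≡sum {zero}  p = refl
countFin≡sum {suc n} p = cong (1 when p zero +_) (countFin≡sum (p ∘ suc))

countFin-cong : ∀ {n} {p q : Fin n → Bool} → (∀ i → p i ≡ q i) → countFin p ≡ countFin q
countFin-cong {zero}  p≗q = refl
countFin-cong {suc n} p≗q = cong₂ (λ b c → 1 when b + c) (p≗q zero) (countFin-cong (p≗q ∘ suc))

⌊⌋-true : ∀ {P : Set} (P? : Dec P) → P → ⌊ P? ⌋ ≡ true
⌊⌋-true P? p = trans (isYes≗does P?) (dec-true P? p)

⌊⌋-sound : ∀ {P : Set} (P? : Dec P) → ⌊ P? ⌋ ≡ true → P
⌊⌋-sound (yes p) _ = p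

suc-== : ∀ {n} (d e : Fin n) → (suc d == suc e) ≡ (d == e)
suc-== d e = trans (isYes≗does (suc d ≟ suc e)) (sym (isYes≗does (d ≟ e)))

sum-select : ∀ {n} (x : Fin n) (A : Fin n → ℕ) → sum (λ e → A e when (x == e)) ≡ A x
sum-select {suc n} zero    A = trans (cong (A zero +_) (sum-zero {n})) (+-identityʳ _)
sum-select {suc n} (suc x) A = trans
  (sum-cong-≗ (λ e → cong (A (suc e) when_) (suc-== x e)))
  (sum-select x (A ∘ suc))

anyFin-intro : ∀ {n} (p : Fin n → Bool) i → p i ≡ true → anyFin p ≡ true
anyFin-intro p zero    pi rewrite pi = refl
anyFin-intro p (suc i) pi with p zero
... | true  = refl
... | false = anyFin-intro (p ∘ suc) i pi

anyFin-elim : ∀ {n} (p : Fin n → Bool) → anyFin p ≡ true → ∃ λ i → p i ≡ true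
anyFin-elim {suc n} p h with p zero in eq
... | true  = zero , eq
... | false = let i , pi = anyFin-elim (p ∘ suc) h in suc i , pi

allFin-elim : ∀ {n} (p : Fin n → Bool) → allFin p ≡ true → ∀ i → p i ≡ true
allFin-elim {suc n} p h zero    with p zero | h
... | true | _ = refl
allFin-elim {suc n} p h (suc i) with p zero | h
... | true | h′ = allFin-elim (p ∘ suc) h′ i

allFin-intro : ∀ {n} (p : Fin n → Bool) → (∀ i → p i ≡ true) → allFin p ≡ true
allFin-intro {zero}  p h = refl
allFin-intro {suc n} p h rewrite h zero = allFin-intro (p ∘ suc) (h ∘ suc)

true-iff : ∀ {b c : Bool} → (b ≡ true → c ≡ true) → (c ≡ true → b ≡ true) → b ≡ c
true-iff {true}  {_}     f g = sym (f refl)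
true-iff {false} {false} f g = refl
true-iff {false} {true}  f g = g refl

least : ∀ {P : ℕ → Set} → (∀ k → Dec (P k)) → ∀ k → P k →
        ∃ λ m → m ≤ k × P m × (∀ j → j < m → ¬ P j)
least P? zero    p0 = 0 , z≤n , p0 , λ _ ()
least P? (suc k) pk with P? 0
... | yes p0 = 0 , z≤n , p0 , λ _ ()
... | no ¬p0 =
  let m , m≤k , pm , below = least (P? ∘ suc) k pk
  in suc m , s≤s m≤k , pm , λ { zero _ → ¬p0 ; (suc j) (s≤s j<m) → below j j<m }

iter-+ : ∀ {A : Set} (f : A → A) i j x → iter f (i + j) x ≡ iter f i (iter f j x)
iter-+ f zero    j x = refl
iter-+ f (suc i) j x = cong f (iter-+ f i j x)

module Orbits {n : ℕ} (f : Fin n → Fin n) (f-injective : ∀ {d e} → f d ≡ f e → d ≡ e) where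

  iter-injective : ∀ k {d e} → iter f k d ≡ iter f k e → d ≡ e
  iter-injective zero    eq = eq
  iter-injective (suc k) eq = iter-injective k (f-injective eq)

  iter-cancel : ∀ {i j} d → i ≤ j → iter f i d ≡ iter f j d → iter f (j ∸ i) d ≡ d
  iter-cancel {i} {j} d i≤j eq = iter-injective i (trans (sym (iter-+ f i (j ∸ i) d))
    (trans (cong (λ k → iter f k d) (m+[n∸m]≡n i≤j)) (sym eq)))

  -- The length is kept as a predecessor: it is then positive by definition, and the short faces in
  -- `face` can be split off by matching.
  record Period (d : Fin n) : Set where
    field
      pred-p   : ℕ
    p : ℕ
    p = suc pred-p
    field
      p≤n      : p ≤ n
      periodic : iter f p d ≡ d
      minimal  : ∀ j → 0 < j → j < p → iter f j d ≢ d

    distinct-< : ∀ {i j} → i < j → j < p → iter f i d ≢ iter f j d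
    distinct-< {i} {j} i<j j<p eq =
      minimal (j ∸ i) (m<n⇒0<n∸m i<j) (≤-<-trans (m∸n≤m j i) j<p) (iter-cancel d (<⇒≤ i<j) eq)

    distinct : ∀ {i j : Fin p} → iter f (toℕ i) d ≡ iter f (toℕ j) d → i ≡ j
    distinct {i} {j} eq with <-cmp (toℕ i) (toℕ j)
    ... | tri< i<j _ _ = contradiction eq (distinct-< i<j (Fin.toℕ<n j))
    ... | tri≈ _ i≡j _ = Fin.toℕ-injective i≡j
    ... | tri> _ _ j<i = contradiction (sym eq) (distinct-< j<i (Fin.toℕ<n i))

    reduce : ∀ k → ∃ λ i → i < p × iter f i d ≡ iter f k d
    reduce zero    = 0 , s≤s z≤n , refl
    reduce (suc k) with reduce k
    ... | i , i<p , eq with m≤n⇒m<n∨m≡n i<p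
    ...   | inj₁ si<p = suc i , si<p , cong f eq
    ...   | inj₂ refl = 0 , s≤s z≤n , trans (sym periodic) (cong f eq)

  -- Two of the `suc n` iterates with exponents up to `n` coincide. Injectivity turns this into a
  -- return to `d`, and `least` picks the first one.
  period : ∀ d → Period d
  period d =
    let i , j , i<j , eq = Fin.pigeonhole (n<1+n n) (λ (i : Fin (suc n)) → iter f (toℕ i) d)
        k , 1+k≡j∸i = positive (m<n⇒0<n∸m i<j)
        returns = subst (λ l → iter f l d ≡ d) (sym 1+k≡j∸i) (iter-cancel d (<⇒≤ i<j) eq)
        m , m≤k , pm , below = least (λ k → iter f (suc k) d ≟ d) k returns
    in record
      { pred-p   = m
      ; p≤n      = ≤-trans (s≤s m≤k) (≤-trans (≤-reflexive 1+k≡j∸i)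
                     (≤-trans (m∸n≤m (toℕ j) (toℕ i)) (≤-pred (Fin.toℕ<n j))))
      ; periodic = pm
      ; minimal  = λ { (suc j) _ (s≤s j<m) → below j j<m }
      }
    where
    positive : ∀ {l} → 0 < l → ∃ λ k → suc k ≡ l
    positive {suc l} _ = l , refl

  inOrbit-intro : ∀ {d e} k → iter f k d ≡ e → inOrbit f d e ≡ true
  inOrbit-intro {d} {e} k eq =
    let i , i<p , eq′ = reduce k
    in anyFin-intro {n} (λ k → iter f (toℕ k) d == e) (fromℕ< (<-≤-trans i<p p≤n)) (⌊⌋-true (_ ≟ e)
         (trans (cong (λ l → iter f l d) (Fin.toℕ-fromℕ< (<-≤-trans i<p p≤n))) (trans eq′ eq)))
    where open Period (period d)

  inOrbit-elim : ∀ {d e} → inOrbit f d e ≡ true → ∃ λ k → iter f k d ≡ e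
  inOrbit-elim {d} {e} h =
    let k , hk = anyFin-elim {n} (λ k → iter f (toℕ k) d == e) h in toℕ k , ⌊⌋-sound (_ ≟ e) hk

  inOrbit-sym : ∀ {d e} → inOrbit f d e ≡ true → inOrbit f e d ≡ true
  inOrbit-sym {d} {e} h =
    let k , eq = inOrbit-elim h
        i , i<p , eq′ = reduce k
    in inOrbit-intro (p ∸ i) (begin
         iter f (p ∸ i) e            ≡⟨ cong (iter f (p ∸ i)) (trans (sym eq) (sym eq′)) ⟩
         iter f (p ∸ i) (iter f i d) ≡⟨ iter-+ f (p ∸ i) i d ⟨
         iter f (p ∸ i + i) d        ≡⟨ cong (λ l → iter f l d) (m∸n+n≡m (<⇒≤ i<p)) ⟩
         iter f p d                  ≡⟨ periodic ⟩
         d                           ∎)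
    where
    open Period (period d)
    open ≡-Reasoning

  inOrbit-trans : ∀ {d e x} → inOrbit f d e ≡ true → inOrbit f e x ≡ true → inOrbit f d x ≡ true
  inOrbit-trans {d} h h′ =
    let k , eq = inOrbit-elim h
        l , eq′ = inOrbit-elim h′
    in inOrbit-intro (l + k) (trans (iter-+ f l k d) (trans (cong (iter f l) eq) eq′))

  inOrbit-step : ∀ d e → inOrbit f (f d) e ≡ inOrbit f d e
  inOrbit-step d e = true-iff (inOrbit-trans step) (inOrbit-trans (inOrbit-sym step))
    where
    step : inOrbit f d (f d) ≡ true
    step = inOrbit-intro 1 refl

  orbitSum : Fin n → (Fin n → ℕ) → ℕ
  orbitSum d A = sum (λ e → A e when inOrbit f d e)

  orbitSum-mono : ∀ d {A B} → (∀ e → inOrbit f d e ≡ true → A e ≤ B e) → orbitSum d A ≤ orbitSum d B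
  orbitSum-mono d {A} {B} h = sum-mono each
    where
    each : ∀ e → A e when inOrbit f d e ≤ B e when inOrbit f d e
    each e with inOrbit f d e in de
    ... | true  = h e de
    ... | false = z≤n

  orbitSum-+ : ∀ d A B → orbitSum d (λ e → A e + B e) ≡ orbitSum d A + orbitSum d B
  orbitSum-+ d A B = trans (sum-cong-≗ each) (∑-distrib-+ (λ e → A e when inOrbit f d e) _)
    where
    each : ∀ e → (A e + B e) when inOrbit f d e ≡ A e when inOrbit f d e + B e when inOrbit f d e
    each e with inOrbit f d e
    ... | true  = refl
    ... | false = refl

  orbitSum-const : ∀ d c → orbitSum d (λ _ → c) ≡ countFin (inOrbit f d) * c
  orbitSum-const d c = sym (begin
    countFin (inOrbit f d) * c           ≡⟨ cong (_* c) (countFin≡sum (inOrbit f d)) ⟩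
    sum (λ e → 1 when inOrbit f d e) * c ≡⟨ sum-*ʳ (λ e → 1 when inOrbit f d e) c ⟩
    sum (λ e → 1 when inOrbit f d e * c) ≡⟨ sum-cong-≗ each ⟩
    orbitSum d (λ _ → c)                 ∎)
    where
    open ≡-Reasoning
    each : ∀ e → 1 when inOrbit f d e * c ≡ c when inOrbit f d e
    each e with inOrbit f d e
    ... | true  = *-identityˡ c
    ... | false = refl

  inOrbit-invariant : ∀ {A : Set} (F : Fin n → A) → (∀ e → F (f e) ≡ F e) →
                      ∀ {d e} → inOrbit f d e ≡ true → F e ≡ F d
  inOrbit-invariant F step {d} h = let k , eq = inOrbit-elim h in trans (cong F (sym eq)) (along k)
    where
    along : ∀ k → F (iter f k d) ≡ F d
    along zero    = refl
    along (suc k) = trans (step _) (along k)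

  -- The exponents below the period list the orbit without repetition, so membership of `e` is a sum
  -- of equality tests of which at most one succeeds. Exchanging the sums leaves one term per
  -- exponent.
  orbitSum-period : ∀ d A → let open Period (period d) in
                    orbitSum d A ≡ sum {p} (λ i → A (iter f (toℕ i) d))
  orbitSum-period d A = begin
    orbitSum d A                                          ≡⟨ sum-cong-≗ split ⟩
    sum (λ e → sum {p} (λ i → A e when (at i == e)))      ≡⟨ ∑-comm {n} {p} (λ e i → A e when (at i == e)) ⟩
    sum {p} (λ i → sum (λ e → A e when (at i == e)))      ≡⟨ sum-cong-≗ (λ i → sum-select (at i) A) ⟩
    sum {p} (λ i → A (at i))                              ∎
    where
    open Period (period d)
    open ≡-Reasoning
    at : Fin p → Fin n
    at i = iter f (toℕ i) d
    split : ∀ e → A e when inOrbit f d e ≡ sum {p} (λ i → A e when (at i == e))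
    split e with inOrbit f d e in eq
    ... | true =
      let k , eqk = inOrbit-elim eq
          i , i<p , eqi = reduce k
          j = fromℕ< i<p
          at-j = trans (cong (λ l → iter f l d) (Fin.toℕ-fromℕ< i<p)) (trans eqi eqk)
      in sym (trans
           (sum-cong-≗ (λ l → cong (A e when_) (true-iff
             (λ h → ⌊⌋-true (j ≟ l) (distinct (trans at-j (sym (⌊⌋-sound (at l ≟ e) h)))))
             (λ h → ⌊⌋-true (at l ≟ e) (trans (cong at (sym (⌊⌋-sound (j ≟ l) h))) at-j)))))
           (sum-select j (λ _ → A e)))
    ... | false = sym (trans (sum-cong-≗ none) (sum-zero {p}))
      where
      none : ∀ i → A e when (at i == e) ≡ 0
      none i with at i ≟ e
      ... | no _    = refl
      ... | yes h with () ← trans (sym eq) (inOrbit-intro (toℕ i) h)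

  count-period : ∀ d → countFin (inOrbit f d) ≡ Period.p (period d)
  count-period d = begin
    countFin (inOrbit f d)  ≡⟨ countFin≡sum (inOrbit f d) ⟩
    orbitSum d (λ _ → 1)    ≡⟨ orbitSum-period d (λ _ → 1) ⟩
    sum {p} (λ _ → 1)       ≡⟨ sum-const p 1 ⟩
    p * 1                   ≡⟨ *-identityʳ p ⟩
    p                       ∎
    where
    open Period (period d)
    open ≡-Reasoning

  -- The length enters through an equation, so that at a vertex of known degree the sum unfolds into
  -- explicit terms.
  orbitSum-count : ∀ d A {p} → countFin (inOrbit f d) ≡ p →
                   iter f p d ≡ d × orbitSum d A ≡ sum {p} (λ i → A (iter f (toℕ i) d))
  orbitSum-count d A eq with trans (sym eq) (count-period d)
  ... | refl = Period.periodic (period d) , orbitSum-period d A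

  isOrbitRep-elim : ∀ {r} → isOrbitRep f r ≡ true → ∀ {e} → inOrbit f r e ≡ true → toℕ r ≤ toℕ e
  isOrbitRep-elim {r} h {e} h′ =
    let k , eq = anyFin-elim {n} (λ k → iter f (toℕ k) r == e) h′
    in subst (λ x → toℕ r ≤ toℕ x) (⌊⌋-sound (iter f (toℕ k) r ≟ e) eq) (⌊⌋-sound (toℕ r ≤? toℕ (iter f (toℕ k) r)) (allFin-elim {n} _ h k))

  representative : ∀ e → ∃ λ r → inOrbit f r e ≡ true × isOrbitRep f r ≡ true
  representative e =
    let m , _ , (r , r≡m , re) , below = least
          (λ k → Fin.any? (λ r → toℕ r ≟ℕ k ×-dec (inOrbit f r e Bool.≟ true))) (toℕ e)
          (e , refl , inOrbit-intro 0 refl)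
    in r , re , allFin-intro {n} _ (λ k → ⌊⌋-true (toℕ r ≤? toℕ (iter f (toℕ k) r)) (≮⇒≥ λ lt →
         below _ (subst (toℕ (iter f (toℕ k) r) <_) r≡m lt)
           (iter f (toℕ k) r , refl , inOrbit-trans (inOrbit-sym (inOrbit-intro (toℕ k) refl)) re)))

  -- After the exchange of sums the term at `e` is counted once for each representative of its
  -- orbit; there is one, and two would both have the least index.
  sum-by-orbits : ∀ A → sum (λ d → orbitSum d A when isOrbitRep f d) ≡ sum A
  sum-by-orbits A = begin
    sum (λ d → orbitSum d A when isOrbitRep f d)
      ≡⟨ sum-cong-≗ (λ d → when-sum (isOrbitRep f d) (λ e → A e when inOrbit f d e)) ⟩
    sum (λ d → sum (λ e → A e when inOrbit f d e when isOrbitRep f d))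
      ≡⟨ ∑-comm {n} {n} (λ d e → A e when inOrbit f d e when isOrbitRep f d) ⟩
    sum (λ e → sum (λ d → A e when inOrbit f d e when isOrbitRep f d))
      ≡⟨ sum-cong-≗ unique ⟩
    sum A ∎
    where
    open ≡-Reasoning
    when-sum : ∀ {m} b (B : Fin m → ℕ) → sum B when b ≡ sum (λ e → B e when b)
    when-sum     true  B = refl
    when-sum {m} false B = sym (sum-zero {m})
    single : ∀ e r → inOrbit f r e ≡ true → isOrbitRep f r ≡ true →
             ∀ d → A e when inOrbit f d e when isOrbitRep f d ≡ A e when (r == d)
    single e r re rep-r d with r ≟ d
    ... | yes refl rewrite re | rep-r = refl
    ... | no r≢d with isOrbitRep f d in rep-d | inOrbit f d e in de
    ...   | false | _     = refl
    ...   | true  | false = refl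
    ...   | true  | true  = contradiction
      (Fin.toℕ-injective (≤-antisym
        (isOrbitRep-elim rep-r (inOrbit-trans re (inOrbit-sym de)))
        (isOrbitRep-elim rep-d (inOrbit-trans de (inOrbit-sym re)))))
      r≢d
    unique : ∀ e → sum (λ d → A e when inOrbit f d e when isOrbitRep f d) ≡ A e
    unique e =
      let r , re , rep-r = representative e
      in trans (sum-cong-≗ (single e r re rep-r)) (sum-select r (λ _ → A e))

  -- The passage from local to global. It serves vertices and faces alike, with `c = 1440`, which is
  -- 6 in units of 1/240.
  orbit-bound : ∀ c A B → (∀ d → orbitSum d B + c ≤ orbitSum d A) → sum B + numOrbits f * c ≤ sum A
  orbit-bound c A B h = begin
    sum B + numOrbits f * c
      ≡⟨ cong₂ (λ x y → x + y * c) (sym (sum-by-orbits B)) (countFin≡sum (isOrbitRep f)) ⟩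
    sum (λ d → orbitSum d B when rep d) + sum (λ d → 1 when rep d) * c
      ≡⟨ cong (sum (λ d → orbitSum d B when rep d) +_) (sum-*ʳ (λ d → 1 when rep d) c) ⟩
    sum (λ d → orbitSum d B when rep d) + sum (λ d → 1 when rep d * c)
      ≡⟨ ∑-distrib-+ (λ d → orbitSum d B when rep d) _ ⟨
    sum (λ d → orbitSum d B when rep d + 1 when rep d * c)
      ≤⟨ sum-mono each ⟩
    sum (λ d → orbitSum d A when rep d)
      ≡⟨ sum-by-orbits A ⟩
    sum A ∎
    where
    open ≤-Reasoning
    rep : Fin n → Bool
    rep = isOrbitRep f
    each : ∀ d → orbitSum d B when rep d + 1 when rep d * c ≤ orbitSum d A when rep d
    each d with rep d
    ... | true  = subst (λ x → orbitSum d B + x ≤ orbitSum d A) (sym (*-identityˡ c)) (h d)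
    ... | false = z≤n

-- Charges around a 5-vertex as a function of the neighbouring degrees

infix 4 _⇛_
_⇛_ : Bool → Bool → Set
b ⇛ c = b ≡ true → c ≡ true

∧-true : ∀ {b c} → b ∧ c ≡ true → b ≡ true × c ≡ true
∧-true {true} {true} _ = refl , refl

∧-mono : ∀ {b b′ c c′} → b ⇛ b′ → c ⇛ c′ → b ∧ c ⇛ b′ ∧ c′
∧-mono {true} f g h rewrite f refl = g h

∨-mono : ∀ {b b′ c c′} → b ⇛ b′ → c ⇛ c′ → b ∨ c ⇛ b′ ∨ c′
∨-mono {true}           f g h rewrite f refl = refl
∨-mono {false} {true}   f g h = refl
∨-mono {false} {false}  f g h = g h

⇛-refl : ∀ b → b ⇛ b
⇛-refl b h = h

when-mono : ∀ {x y b c} → x ≤ y → b ⇛ c → x when b ≤ y when c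
when-mono {b = false} x≤y f = z≤n
when-mono {b = true}  x≤y f rewrite f refl = x≤y

≤ᵇ-sound : ∀ {a b} → (a ≤ᵇ b) ≡ true → a ≤ b
≤ᵇ-sound {a} {b} h = ≤ᵇ⇒≤ a b (subst T (sym h) tt)

≤ᵇ-complete : ∀ {a b} → a ≤ b → (a ≤ᵇ b) ≡ true
≤ᵇ-complete {a} {b} a≤b with a ≤ᵇ b in eq
... | true  = refl
... | false = contradiction (subst T eq (≤⇒≤ᵇ a≤b)) (λ ())

≤ᵇ-monoʳ : ∀ c {a b} → a ≤ b → (c ≤ᵇ a) ⇛ (c ≤ᵇ b)
≤ᵇ-monoʳ c a≤b h = ≤ᵇ-complete (≤-trans (≤ᵇ-sound {c} h) a≤b)

≤ᵇ-monoˡ : ∀ c {a b} → a ≤ b → (b ≤ᵇ c) ⇛ (a ≤ᵇ c)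
≤ᵇ-monoˡ c {b = b} a≤b h = ≤ᵇ-complete (≤-trans a≤b (≤ᵇ-sound {b} h))

_≤ᵇᴮ_ : ℕ → Bound → Bool
k ≤ᵇᴮ fin m = k ≤ᵇ m
k ≤ᵇᴮ ∞     = true

_ᴮ≤ᵇ_ : Bound → ℕ → Bool
fin m ᴮ≤ᵇ k = m ≤ᵇ k
∞     ᴮ≤ᵇ k = false

≤ᵇᴮ-mono : ∀ c {t} h → t ≤ᴮ h → (c ≤ᵇ t) ⇛ (c ≤ᵇᴮ h)
≤ᵇᴮ-mono c (fin m) t≤h = ≤ᵇ-monoʳ c t≤h
≤ᵇᴮ-mono c ∞       t≤h = λ _ → refl

ᴮ≤ᵇ-mono : ∀ c {t} h → t ≤ᴮ h → (h ᴮ≤ᵇ c) ⇛ (t ≤ᵇ c)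
ᴮ≤ᵇ-mono c (fin m) t≤h = ≤ᵇ-monoˡ c t≤h
ᴮ≤ᵇ-mono c ∞       t≤h = λ ()

-- A step function given by its jumps; monotonicity then needs no comparison of values.
stepSum : List (ℕ × ℕ) → (ℕ → Bool) → ℕ
stepSum []             p = 0
stepSum ((c , a) ∷ cs) p = a when p c + stepSum cs p

stepSum-mono : ∀ cs {p q : ℕ → Bool} → (∀ c → p c ⇛ q c) → stepSum cs p ≤ stepSum cs q
stepSum-mono []             f = z≤n
stepSum-mono ((c , a) ∷ cs) f = +-mono-≤ (when-mono (≤-refl {a}) (f c)) (stepSum-mono cs f)

-- Charges are multiples of 1/240.  A vertex of degree k ≥ 8 sends 2 · half k ≤ 240 (k ∸ 6) / k along
-- each dart; a dart leading to a vertex of degree at least 6 passes its two halves on to the neighbouring darts.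
halfSteps : List (ℕ × ℕ)
halfSteps =
  (8 , 30) ∷ (9 , 10) ∷ (10 , 8) ∷ (11 , 6) ∷ (12 , 6) ∷ (14 , 6) ∷ (15 , 6) ∷ (16 , 3) ∷ (18 , 5) ∷ (24 , 10) ∷ []

half : ℕ → ℕ
half k = stepSum halfSteps (_≤ᵇ k)

half-mono : ∀ {k l} → k ≤ l → half k ≤ half l
half-mono k≤l = stepSum-mono halfSteps (λ c → ≤ᵇ-monoʳ c k≤l)

-- The amount for a 5-neighbour. `p` and `q` say that the dart on either side leads to a vertex of
-- degree at least 6 across a triangle; 60 is the 1/4 sent by a 7-vertex.
sends : ℕ → Bool → Bool → ℕ
sends k p q =
  if k ≤ᵇ 7
  then 60 when ((7 ≤ᵇ k) ∧ (p ∨ q))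
  else half k + half k + half k when p + half k when q

sends-mono : ∀ {k l p p′ q q′} → k ≤ l → p ⇛ p′ → q ⇛ q′ → sends k p q ≤ sends l p′ q′
sends-mono {k} {l} {p} {p′} {q} {q′} k≤l f g with k ≤ᵇ 7 in k7 | l ≤ᵇ 7 in l7
... | true  | true  = when-mono (≤-refl {60}) (∧-mono (≤ᵇ-monoʳ 7 k≤l) (∨-mono {p} f g))
-- Here `k ≤ 7 < l`, and 60 is exactly `half 8 + half 8`.
... | true  | false = ≤-trans (at-most-60 ((7 ≤ᵇ k) ∧ (p ∨ q)))
  (≤-trans (+-mono-≤ big big) (≤-trans (m≤m+n (half l + half l) (half l when p′)) (m≤m+n _ (half l when q′))))
  where
  at-most-60 : ∀ b → 60 when b ≤ 60
  at-most-60 true  = ≤-refl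
  at-most-60 false = z≤n
  big : 30 ≤ half l
  big = ≤-trans (≤ᵇ-sound {30} {half 8} refl)
    (half-mono {8} {l} (≰⇒> λ l≤7 → contradiction (trans (sym l7) (≤ᵇ-complete l≤7)) λ ()))
... | false | true  = contradiction (trans (sym k7) (≤ᵇ-complete (≤-trans k≤l (≤ᵇ-sound {l} l7)))) λ ()
... | false | false = +-mono-≤ (+-mono-≤ (+-mono-≤ h h) (when-mono h f)) (when-mono h g)
  where
  h : half k ≤ half l
  h = half-mono k≤l

-- The additional charge of a star ⟨k,5,K,5,5⟩ whose k-vertex and K-vertex do not suffice;
-- on a box of degrees only the lower end lo ≤ k ≤ hi is certain.
extra : ℕ → Bound → ℕ → ℕ
extra lo hi K =
    60 when ((7 ≤ᵇ lo) ∧ (hi ᴮ≤ᵇ 7) ∧ (24 ≤ᵇ K))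
  + 30 when ((8 ≤ᵇ lo) ∧ (hi ᴮ≤ᵇ 8) ∧ (16 ≤ᵇ K))
  + 16 when ((9 ≤ᵇ lo) ∧ (hi ᴮ≤ᵇ 9) ∧ (15 ≤ᵇ K))

-- A payer is estimated to see only one of the two degrees that determine `extra`, so its payment is
-- bounded through K alone or through k alone. The jumps add up to the values 16, 30, 60, upwards in
-- K and downwards in k.
KSteps kSteps : List (ℕ × ℕ)
KSteps = (15 , 16) ∷ (16 , 14) ∷ (24 , 30) ∷ []
kSteps = (7 , 30) ∷ (8 , 14) ∷ (9 , 16) ∷ []

extra≤K : Bound → ℕ
extra≤K K = stepSum KSteps (_≤ᵇᴮ K)

extra≤k : ℕ → Bound → ℕ
extra≤k lo hi = stepSum kSteps (lo ≤ᵇ_) when (7 ≤ᵇᴮ hi)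

-- A star is recorded by the degrees of its five neighbours in cyclic order and by five flags, the
-- i-th of which says that the face between the (i-1)-st and the i-th neighbour is not a triangle.
-- gain and loss are what the centre receives and pays along its first dart, estimated over the
-- degrees in the box between lo and hi.
gain loss : Vec ℕ 5 → Vec Bound 5 → Vec Bool 5 → ℕ
gain (a0 ∷ a1 ∷ a2 ∷ a3 ∷ a4 ∷ []) (h0 ∷ h1 ∷ h2 ∷ h3 ∷ h4 ∷ []) (m0 ∷ m1 ∷ m2 ∷ m3 ∷ m4 ∷ []) =
  120 when m0
  + (sends a0 ((6 ≤ᵇ a1) ∧ not m1) ((6 ≤ᵇ a4) ∧ not m0)
     + (60 when ((6 ≤ᵇ a0) ∧ m0) + 60 when ((6 ≤ᵇ a0) ∧ m1)))
  + (extra a2 h2 a4 when ((h0 ᴮ≤ᵇ 5) ∧ (h1 ᴮ≤ᵇ 5) ∧ (h3 ᴮ≤ᵇ 5) ∧ not (m0 ∨ m1 ∨ m2 ∨ m3 ∨ m4))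
  + extra a3 h3 a1 when ((h0 ᴮ≤ᵇ 5) ∧ (h4 ᴮ≤ᵇ 5) ∧ (h2 ᴮ≤ᵇ 5) ∧ not (m1 ∨ m0 ∨ m4 ∨ m3 ∨ m2)))
loss (a0 ∷ a1 ∷ a2 ∷ a3 ∷ a4 ∷ []) (h0 ∷ h1 ∷ h2 ∷ h3 ∷ h4 ∷ []) (m0 ∷ m1 ∷ m2 ∷ m3 ∷ m4 ∷ []) =
  (extra≤K h1 when ((a0 ≤ᵇ 5) ∧ (a4 ≤ᵇ 5) ∧ ((12 ≤ᵇᴮ h3) ∨ m4))
   + extra≤k a4 h4 when ((a0 ≤ᵇ 5) ∧ (a1 ≤ᵇ 5) ∧ (a2 ≤ᵇ 11)))
  + (extra≤K h4 when ((a0 ≤ᵇ 5) ∧ (a1 ≤ᵇ 5) ∧ ((12 ≤ᵇᴮ h2) ∨ m2))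
   + extra≤k a1 h1 when ((a0 ≤ᵇ 5) ∧ (a4 ≤ᵇ 5) ∧ (a3 ≤ᵇ 11)))

rotl : ∀ {A : Set} → Vec A 5 → Vec A 5
rotl (a ∷ b ∷ c ∷ d ∷ e ∷ []) = b ∷ c ∷ d ∷ e ∷ a ∷ []

around : (Vec ℕ 5 → Vec Bound 5 → Vec Bool 5 → ℕ) → ℕ → Vec ℕ 5 → Vec Bound 5 → Vec Bool 5 → ℕ
around f zero    a h m = 0
around f (suc k) a h m = f a h m + around f k (rotl a) (rotl h) (rotl m)

InBox : Vec ℕ 5 → Vec Bound 5 → Vec ℕ 5 → Set
InBox lo hi t = Pointwise _≤_ lo t × Pointwise _≤ᴮ_ t hi

extra-mono : ∀ {lo hi K t T} → lo ≤ t → t ≤ᴮ hi → K ≤ T → extra lo hi K ≤ extra t (fin t) T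
extra-mono {lo} {hi} {K} {t} {T} lo≤t t≤hi K≤T = +-mono-≤ (+-mono-≤ (piece 60 7 24) (piece 30 8 16)) (piece 16 9 15)
  where
  piece : ∀ x c d → x when ((c ≤ᵇ lo) ∧ (hi ᴮ≤ᵇ c) ∧ (d ≤ᵇ K)) ≤ x when ((c ≤ᵇ t) ∧ (t ≤ᵇ c) ∧ (d ≤ᵇ T))
  piece x c d = when-mono (≤-refl {x})
    (∧-mono (≤ᵇ-monoʳ c lo≤t) (∧-mono (ᴮ≤ᵇ-mono c hi t≤hi) (≤ᵇ-monoʳ d K≤T)))

extra≤K-mono : ∀ {t} h → t ≤ᴮ h → extra≤K (fin t) ≤ extra≤K h
extra≤K-mono h t≤h = stepSum-mono KSteps (λ c → ≤ᵇᴮ-mono c h t≤h)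

extra≤k-mono : ∀ {lo t} h → lo ≤ t → t ≤ᴮ h → extra≤k t (fin t) ≤ extra≤k lo h
extra≤k-mono h lo≤t t≤h =
  when-mono (stepSum-mono kSteps (λ c → ≤ᵇ-monoˡ c lo≤t)) (≤ᵇᴮ-mono 7 h t≤h)

-- In `gain` every condition that asks for a large degree is read at `lo` and every one that asks
-- for a small degree at `hi`; in `loss` it is the other way round.
gain-mono : ∀ {lo hi t} m → InBox lo hi t → gain lo hi m ≤ gain t (map fin t) m
gain-mono {hi = h0 ∷ h1 ∷ h2 ∷ h3 ∷ h4 ∷ []} (m0 ∷ m1 ∷ m2 ∷ m3 ∷ m4 ∷ [])
  ((a0 ∷ a1 ∷ a2 ∷ a3 ∷ a4 ∷ []) , (b0 ∷ b1 ∷ b2 ∷ b3 ∷ b4 ∷ [])) =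
  +-mono-≤ (+-mono-≤ (≤-refl {120 when m0}) (+-mono-≤
    (sends-mono a0 (∧-mono (≤ᵇ-monoʳ 6 a1) (⇛-refl (not m1))) (∧-mono (≤ᵇ-monoʳ 6 a4) (⇛-refl (not m0))))
    (+-mono-≤ (when-mono (≤-refl {60}) (∧-mono (≤ᵇ-monoʳ 6 a0) (⇛-refl m0)))
              (when-mono (≤-refl {60}) (∧-mono (≤ᵇ-monoʳ 6 a0) (⇛-refl m1))))))
    (+-mono-≤
      (when-mono (extra-mono {hi = h2} a2 b2 a4)
        (∧-mono (ᴮ≤ᵇ-mono 5 h0 b0) (∧-mono (ᴮ≤ᵇ-mono 5 h1 b1) (∧-mono (ᴮ≤ᵇ-mono 5 h3 b3) (⇛-refl (not (m0 ∨ m1 ∨ m2 ∨ m3 ∨ m4)))))))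
      (when-mono (extra-mono {hi = h3} a3 b3 a1)
        (∧-mono (ᴮ≤ᵇ-mono 5 h0 b0) (∧-mono (ᴮ≤ᵇ-mono 5 h4 b4) (∧-mono (ᴮ≤ᵇ-mono 5 h2 b2) (⇛-refl (not (m1 ∨ m0 ∨ m4 ∨ m3 ∨ m2))))))))

loss-mono : ∀ {lo hi t} m → InBox lo hi t → loss t (map fin t) m ≤ loss lo hi m
loss-mono {hi = h0 ∷ h1 ∷ h2 ∷ h3 ∷ h4 ∷ []} (m0 ∷ m1 ∷ m2 ∷ m3 ∷ m4 ∷ [])
  ((a0 ∷ a1 ∷ a2 ∷ a3 ∷ a4 ∷ []) , (b0 ∷ b1 ∷ b2 ∷ b3 ∷ b4 ∷ [])) =
  +-mono-≤
    (+-mono-≤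
      (when-mono (extra≤K-mono h1 b1) (∧-mono (≤ᵇ-monoˡ 5 a0) (∧-mono (≤ᵇ-monoˡ 5 a4) (∨-mono (≤ᵇᴮ-mono 12 h3 b3) (⇛-refl m4)))))
      (when-mono (extra≤k-mono h4 a4 b4) (∧-mono (≤ᵇ-monoˡ 5 a0) (∧-mono (≤ᵇ-monoˡ 5 a1) (≤ᵇ-monoˡ 11 a2)))))
    (+-mono-≤
      (when-mono (extra≤K-mono h4 b4) (∧-mono (≤ᵇ-monoˡ 5 a0) (∧-mono (≤ᵇ-monoˡ 5 a1) (∨-mono (≤ᵇᴮ-mono 12 h2 b2) (⇛-refl m2)))))
      (when-mono (extra≤k-mono h1 a1 b1) (∧-mono (≤ᵇ-monoˡ 5 a0) (∧-mono (≤ᵇ-monoˡ 5 a4) (≤ᵇ-monoˡ 11 a3)))))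

rotl-pointwise : ∀ {A B : Set} {R : A → B → Set} {xs ys} → Pointwise R xs ys → Pointwise R (rotl xs) (rotl ys)
rotl-pointwise (a ∷ b ∷ c ∷ d ∷ e ∷ []) = b ∷ c ∷ d ∷ e ∷ a ∷ []

rotl-map : ∀ {A B : Set} (f : A → B) (xs : Vec A 5) → rotl (map f xs) ≡ map f (rotl xs)
rotl-map f (a ∷ b ∷ c ∷ d ∷ e ∷ []) = refl

rotl-box : ∀ {lo hi t} → InBox lo hi t → InBox (rotl lo) (rotl hi) (rotl t)
rotl-box (l , h) = rotl-pointwise l , rotl-pointwise h

around-gain-mono : ∀ k {lo hi t} m → InBox lo hi t → around gain k lo hi m ≤ around gain k t (map fin t) m
around-gain-mono zero    m b = z≤n
around-gain-mono (suc k) {t = t} m b rewrite rotl-map fin t =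
  +-mono-≤ (gain-mono m b) (around-gain-mono k (rotl m) (rotl-box b))

around-loss-mono : ∀ k {lo hi t} m → InBox lo hi t → around loss k t (map fin t) m ≤ around loss k lo hi m
around-loss-mono zero    m b = z≤n
around-loss-mono (suc k) {t = t} m b rewrite rotl-map fin t =
  +-mono-≤ (loss-mono m b) (around-loss-mono k (rotl m) (rotl-box b))

-- The initial charge of a 5-vertex is `5 - 6`, that is, 240 units are missing.
Balanced : Vec ℕ 5 → Vec Bool 5 → Set
Balanced t m = 240 + around loss 5 t (map fin t) m ≤ around gain 5 t (map fin t) m

-- Verified search over boxes of degrees

cut : ∀ {n} → Vec Bound n → Vec Bound n → Maybe (Fin n × ℕ)
cut []          []            = nothing
cut (∞ ∷ κ)     (h ∷ hi)      = Maybe.map (Product.map₁ suc) (cut κ hi)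
cut (fin c ∷ κ) (∞ ∷ hi)      = just (zero , c)
cut (fin c ∷ κ) (fin h ∷ hi)  = if h ≤ᵇ c then Maybe.map (Product.map₁ suc) (cut κ hi) else just (zero , c)

cut-nothing : ∀ {n} (κ hi : Vec Bound n) {t : Vec ℕ n} → cut κ hi ≡ nothing → Pointwise _≤ᴮ_ t hi → Pointwise _≤ᴮ_ t κ
cut-nothing []          []           eq []      = []
cut-nothing (∞ ∷ κ)     (h ∷ hi)     eq (_ ∷ b) with cut κ hi in eq′
... | nothing = tt ∷ cut-nothing κ hi eq′ b
cut-nothing (fin c ∷ κ) (fin h ∷ hi) eq (a ∷ b) with h ≤ᵇ c in h≤c | cut κ hi in eq′
... | true | nothing = ≤-trans a (≤ᵇ-sound {h} h≤c) ∷ cut-nothing κ hi eq′ b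

firstThreshold : List ℕ → ℕ → Bound → Maybe ℕ
firstThreshold []       a h = nothing
firstThreshold (c ∷ cs) a h = if (a ≤ᵇ c) ∧ (suc c ≤ᵇᴮ h) then just c else firstThreshold cs a h

threshold : ∀ {n} → Vec ℕ n → Vec Bound n → Maybe (Fin n × ℕ)
threshold []       []       = nothing
-- Each value is the last degree before some condition of the rules changes or some step function
-- jumps.
threshold (a ∷ lo) (h ∷ hi) with firstThreshold (5 ∷ 6 ∷ 7 ∷ 8 ∷ 9 ∷ 11 ∷ 14 ∷ 15 ∷ 23 ∷ []) a h
... | just c  = just (zero , c)
... | nothing = Maybe.map (Product.map₁ suc) (threshold lo hi)

-- A box is divided until its lowest charge suffices or it lies inside a forbidden star; the cuts are
-- taken along a forbidden star that the box still meets, and at the thresholds of the rules if there is none.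
search : ℕ → Vec Bool 5 → List (Vec Bound 5) → Vec ℕ 5 → Vec Bound 5 → Bool
divide : ℕ → Vec Bool 5 → List (Vec Bound 5) → Vec ℕ 5 → Vec Bound 5 → Fin 5 → ℕ → Bool
refine : ℕ → Vec Bool 5 → List (Vec Bound 5) → Vec ℕ 5 → Vec Bound 5 → Bool

divide f m κs lo hi i c =
  search f m κs lo (hi [ i ]≔ fin c)
  -- The part above `c` no longer meets a star whose `i`-th bound is at most `c`.
  ∧ search f m (filterᵇ (λ κ → suc c ≤ᵇᴮ lookup κ i) κs) (lo [ i ]≔ suc c) hi

refine f m [] lo hi with threshold lo hi
... | just (i , c) = divide f m [] lo hi i c
... | nothing      = false
refine f m (κ ∷ κs) lo hi with cut κ hi
... | just (i , c) = divide f m (κ ∷ κs) lo hi i c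
... | nothing      = true

-- Exhausted fuel counts as failure, so soundness does not depend on the amount of fuel.
search zero    m κs lo hi = false
search (suc f) m κs lo hi =
  (240 + around loss 5 lo hi m ≤ᵇ around gain 5 lo hi m) ∨ refine f m κs lo hi

update-pointwise : ∀ {n} {A B : Set} {R : A → B → Set} {xs : Vec A n} {ys : Vec B n} (i : Fin n) {y} →
                   Pointwise R xs ys → R (lookup xs i) y → Pointwise R xs (ys [ i ]≔ y)
update-pointwise zero    (_ ∷ rs) r = r ∷ rs
update-pointwise (suc i) (r′ ∷ rs) r = r′ ∷ update-pointwise i rs r

update-pointwiseˡ : ∀ {n} {A B : Set} {R : A → B → Set} {xs : Vec A n} {ys : Vec B n} (i : Fin n) {x} →
                    Pointwise R xs ys → R x (lookup ys i) → Pointwise R (xs [ i ]≔ x) ys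
update-pointwiseˡ zero    (_ ∷ rs) r = r ∷ rs
update-pointwiseˡ (suc i) (r′ ∷ rs) r = r′ ∷ update-pointwiseˡ i rs r

Avoids : Vec ℕ 5 → Vec Bound 5 → Set
Avoids t κ = ¬ Pointwise _≤ᴮ_ t κ

module _ (t : Vec ℕ 5) (m : Vec Bool 5) where

  avoids-filter : ∀ p {κs} → All (Avoids t) κs → All (Avoids t) (filterᵇ p κs)
  avoids-filter p []                = []
  avoids-filter p {κ ∷ κs} (a ∷ as) with p κ
  ... | true  = a ∷ avoids-filter p as
  ... | false = avoids-filter p as

  search-sound : ∀ f {κs lo hi} → All (Avoids t) κs → InBox lo hi t → search f m κs lo hi ≡ true → Balanced t m
  divide-sound : ∀ f {κs lo hi} i c → All (Avoids t) κs → InBox lo hi t → divide f m κs lo hi i c ≡ true → Balanced t m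
  refine-sound : ∀ f {κs lo hi} → All (Avoids t) κs → InBox lo hi t → refine f m κs lo hi ≡ true → Balanced t m

  divide-sound f i c av (l , h) eq with lookup t i ≤? c
  ... | yes ti≤c = search-sound f av (l , update-pointwise i h ti≤c) (proj₁ (∧-true eq))
  ... | no  ti≰c = search-sound f (avoids-filter (λ κ → suc c ≤ᵇᴮ lookup κ i) av) (update-pointwiseˡ i l (≰⇒> ti≰c) , h) (proj₂ (∧-true eq))

  refine-sound f {[]} {lo} {hi} av b eq with threshold lo hi
  ... | just (i , c) = divide-sound f i c av b eq
  refine-sound f {κ ∷ κs} {lo} {hi} (a ∷ av) b eq with cut κ hi in eq′
  ... | just (i , c) = divide-sound f i c (a ∷ av) b eq
  ... | nothing      = contradiction (cut-nothing κ hi eq′ (proj₂ b)) a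

  search-sound (suc f) {κs} {lo} {hi} av b eq
    with 240 + around loss 5 lo hi m ≤ᵇ around gain 5 lo hi m in ok
  ... | true  = ≤-trans (+-monoʳ-≤ 240 (around-loss-mono 5 m b))
                  (≤-trans (≤ᵇ-sound {240 + around loss 5 lo hi m} ok) (around-gain-mono 5 m b))
  ... | false = refine-sound f av b eq

∀ᵇ : ∀ n → (Vec Bool n → Bool) → Bool
∀ᵇ zero    p = p []
∀ᵇ (suc n) p = ∀ᵇ n (λ bs → p (true ∷ bs)) ∧ ∀ᵇ n (λ bs → p (false ∷ bs))

∀ᵇ-sound : ∀ {n} (p : Vec Bool n → Bool) → ∀ᵇ n p ≡ true → ∀ bs → p bs ≡ true
∀ᵇ-sound p h []           = h
∀ᵇ-sound p h (true ∷ bs)  = ∀ᵇ-sound (λ bs → p (true ∷ bs)) (proj₁ (∧-true h)) bs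
∀ᵇ-sound p h (false ∷ bs) = ∀ᵇ-sound (λ bs → p (false ∷ bs)) (proj₂ (∧-true h)) bs

-- The forbidden stars in all positions and the certificate

mirror : ∀ {A : Set} → Vec A 5 → Vec A 5
mirror (a ∷ b ∷ c ∷ d ∷ e ∷ []) = a ∷ e ∷ d ∷ c ∷ b ∷ []

rotations : ∀ {A : Set} → ℕ → Vec A 5 → List (Vec A 5)
rotations zero    κ = []
rotations (suc k) κ = κ ∷ rotations k (rotl κ)

-- The ten images under the symmetries of the pentagon: the search reads the neighbours from one
-- fixed dart in one fixed orientation.
images : List (Vec Bound 5) → List (Vec Bound 5)
images = concatMap (λ κ → rotations 5 κ ++ rotations 5 (mirror κ))

stars : List (Vec Bound 5)
stars =
  ( (fin 5 ∷ fin 5 ∷ fin 5 ∷ fin 7 ∷ fin 17 ∷ [])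
  ∷ (fin 7 ∷ fin 5 ∷ fin 5 ∷ fin 7 ∷ fin 11 ∷ [])
  ∷ (fin 7 ∷ fin 5 ∷ fin 5 ∷ fin 8 ∷ fin 9 ∷ [])
  ∷ (fin 7 ∷ fin 5 ∷ fin 5 ∷ fin 9 ∷ fin 8 ∷ [])
  ∷ (fin 7 ∷ fin 5 ∷ fin 5 ∷ fin 11 ∷ fin 7 ∷ [])
  ∷ (fin 5 ∷ fin 5 ∷ fin 5 ∷ fin 8 ∷ fin 11 ∷ [])
  ∷ (fin 8 ∷ fin 5 ∷ fin 5 ∷ fin 9 ∷ fin 7 ∷ [])
  ∷ (fin 8 ∷ fin 5 ∷ fin 5 ∷ fin 11 ∷ fin 6 ∷ [])
  ∷ (fin 6 ∷ fin 6 ∷ fin 6 ∷ fin 6 ∷ fin 11 ∷ [])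
  ∷ (fin 6 ∷ fin 6 ∷ fin 6 ∷ fin 7 ∷ fin 9 ∷ [])
  ∷ (fin 6 ∷ fin 6 ∷ fin 7 ∷ fin 6 ∷ fin 9 ∷ [])
  ∷ (fin 6 ∷ fin 6 ∷ fin 7 ∷ fin 7 ∷ fin 7 ∷ [])
  ∷ (fin 6 ∷ fin 7 ∷ fin 6 ∷ fin 7 ∷ fin 7 ∷ [])
  ∷ (fin 5 ∷ fin 6 ∷ fin 6 ∷ fin 8 ∷ fin 9 ∷ [])
  ∷ (fin 5 ∷ fin 6 ∷ fin 8 ∷ fin 6 ∷ fin 9 ∷ [])
  ∷ (fin 5 ∷ fin 6 ∷ fin 7 ∷ fin 7 ∷ fin 9 ∷ [])
  ∷ (fin 5 ∷ fin 6 ∷ fin 6 ∷ fin 7 ∷ fin 11 ∷ [])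
  ∷ (fin 5 ∷ fin 6 ∷ fin 7 ∷ fin 6 ∷ fin 11 ∷ [])
  ∷ (fin 5 ∷ fin 7 ∷ fin 6 ∷ fin 7 ∷ fin 9 ∷ [])
  ∷ (fin 5 ∷ fin 7 ∷ fin 7 ∷ fin 6 ∷ fin 9 ∷ [])
  ∷ (fin 5 ∷ fin 6 ∷ fin 6 ∷ fin 6 ∷ fin 17 ∷ [])
  ∷ (fin 5 ∷ fin 7 ∷ fin 6 ∷ fin 6 ∷ fin 11 ∷ [])
  ∷ (fin 5 ∷ fin 8 ∷ fin 6 ∷ fin 6 ∷ fin 10 ∷ [])
  ∷ (fin 5 ∷ fin 9 ∷ fin 6 ∷ fin 6 ∷ fin 9 ∷ [])
  ∷ (fin 5 ∷ fin 5 ∷ fin 9 ∷ fin 6 ∷ fin 9 ∷ [])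
  ∷ (fin 5 ∷ fin 6 ∷ fin 6 ∷ fin 5 ∷ ∞ ∷ [])
  ∷ (fin 5 ∷ fin 6 ∷ fin 7 ∷ fin 5 ∷ fin 23 ∷ [])
  ∷ (fin 5 ∷ fin 6 ∷ fin 8 ∷ fin 5 ∷ fin 15 ∷ [])
  ∷ (fin 5 ∷ fin 6 ∷ fin 9 ∷ fin 5 ∷ fin 14 ∷ [])
  ∷ (fin 5 ∷ fin 9 ∷ fin 5 ∷ fin 6 ∷ fin 10 ∷ [])
  ∷ (fin 5 ∷ fin 8 ∷ fin 5 ∷ fin 6 ∷ fin 11 ∷ [])
  ∷ (fin 5 ∷ fin 7 ∷ fin 5 ∷ fin 6 ∷ fin 17 ∷ [])
  ∷ (fin 5 ∷ fin 7 ∷ fin 7 ∷ fin 5 ∷ fin 11 ∷ [])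
  ∷ (fin 5 ∷ fin 7 ∷ fin 8 ∷ fin 5 ∷ fin 9 ∷ [])
  ∷ (fin 5 ∷ fin 8 ∷ fin 5 ∷ fin 7 ∷ fin 9 ∷ [])
  ∷ (fin 5 ∷ fin 7 ∷ fin 5 ∷ fin 7 ∷ fin 11 ∷ [])
  ∷ (fin 5 ∷ fin 7 ∷ fin 5 ∷ fin 8 ∷ fin 10 ∷ [])
  ∷ (fin 5 ∷ fin 7 ∷ fin 5 ∷ fin 9 ∷ fin 9 ∷ [])
  ∷ (fin 5 ∷ fin 5 ∷ fin 10 ∷ fin 5 ∷ fin 14 ∷ [])
  ∷ (fin 5 ∷ fin 5 ∷ fin 11 ∷ fin 5 ∷ fin 13 ∷ [])
  ∷ [])


searchAll : Vec Bool 5 → Bool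
searchAll m = search 40 m (images stars) (replicate 5 5) (replicate 5 ∞)

-- The whole case analysis, for each of the 32 patterns of triangular and other faces, is evaluated
-- by the type checker here.
certificate : ∀ᵇ 5 searchAll ≡ true
certificate = refl

-- Payments between 5-vertices

when-bound : ∀ {x y b c} → (b ≡ true → c ≡ true × x ≤ y) → x when b ≤ y when c
when-bound {b = false} f = z≤n
when-bound {b = true}  f with f refl
... | refl , x≤y = x≤y

when-split : ∀ x b → x when b + x when not b ≡ x
when-split x true  = +-identityʳ x
when-split x false = refl

when-∧ : ∀ x b c → x when b when c ≡ x when (b ∧ c)
when-∧ x true  c     = refl
when-∧ x false true  = refl
when-∧ x false false = refl

not-true : ∀ {b} → not b ≡ true → b ≡ false
not-true {false} _ = refl

∨-false : ∀ {b c} → b ∨ c ≡ false → b ≡ false × c ≡ false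
∨-false {false} {false} _ = refl , refl

≤ᵇ-false : ∀ {a b} → (a ≤ᵇ b) ≡ false → b < a
≤ᵇ-false {a} {b} eq with a ≤? b
... | yes a≤b = contradiction (trans (sym eq) (≤ᵇ-complete a≤b)) λ ()
... | no  a≰b = ≰⇒> a≰b

extra-≤K : ∀ k K → extra k (fin k) K ≤ extra≤K (fin K)
extra-≤K 0 K = z≤n
extra-≤K 1 K = z≤n
extra-≤K 2 K = z≤n
extra-≤K 3 K = z≤n
extra-≤K 4 K = z≤n
extra-≤K 5 K = z≤n
extra-≤K 6 K = z≤n
extra-≤K 7 K with 24 ≤ᵇ K in eq
... | false = z≤n
... | true rewrite ≤ᵇ-complete {15} {K} (≤-trans (≤ᵇ-sound {15} {24} refl) (≤ᵇ-sound {24} eq))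
                 | ≤ᵇ-complete {16} {K} (≤-trans (≤ᵇ-sound {16} {24} refl) (≤ᵇ-sound {24} eq)) = ≤-refl
extra-≤K 8 K with 16 ≤ᵇ K in eq
... | false = z≤n
... | true rewrite ≤ᵇ-complete {15} {K} (≤-trans (≤ᵇ-sound {15} {16} refl) (≤ᵇ-sound {16} eq)) = m≤m+n 30 _
extra-≤K 9 K = m≤m+n (16 when (15 ≤ᵇ K)) _
extra-≤K (suc (suc (suc (suc (suc (suc (suc (suc (suc (suc k)))))))))) K = z≤n

extra-≤k : ∀ k K → extra k (fin k) K ≤ extra≤k k (fin k)
extra-≤k 0 K = z≤n
extra-≤k 1 K = z≤n
extra-≤k 2 K = z≤n
extra-≤k 3 K = z≤n
extra-≤k 4 K = z≤n
extra-≤k 5 K = z≤n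
extra-≤k 6 K = z≤n
extra-≤k 7 K with 24 ≤ᵇ K
... | false = z≤n
... | true  = ≤-refl
extra-≤k 8 K with 16 ≤ᵇ K
... | false = z≤n
... | true  = ≤-refl
extra-≤k 9 K with 15 ≤ᵇ K
... | false = z≤n
... | true  = ≤-refl
extra-≤k (suc (suc (suc (suc (suc (suc (suc (suc (suc (suc k)))))))))) K = z≤n

-- Stated for an abstract rotation so that it applies to both orientations. Here `gap d` concerns
-- the corner between `d` and `r d`, and `triangle` says that the third side of a triangle is the
-- same edge seen from either of its ends.
module Donations
  (M : RotationSystem)
  (r r⁻ : Dart M → Dart M)
  (rr⁻ : ∀ d → r (r⁻ d) ≡ d)
  (r⁻r : ∀ d → r⁻ (r d) ≡ d)
  (deg-r : ∀ d → deg M (r d) ≡ deg M d)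
  (closed : ∀ d → deg M d ≤ 5 → r (r (r (r (r d)))) ≡ d)
  (gap : Dart M → Bool)
  (triangle : ∀ d → gap d ≡ false → opp M (r⁻ (opp M d)) ≡ r (opp M (r d)))
  (sum-r⁻ : ∀ F → sum (λ d → F (r⁻ d)) ≡ sum F)
  (sum-opp : ∀ F → sum (λ d → F (opp M d)) ≡ sum F)
  where

  open RotationSystem M using (α-invol)

  private
    o : Dart M → Dart M
    o = opp M

    o-o : ∀ d → o (o d) ≡ d
    o-o = α-invol

    e : Dart M → ℕ
    e d = deg M (o d)

    deg-r⁻ : ∀ d → deg M (r⁻ d) ≡ deg M d
    deg-r⁻ d = trans (sym (deg-r (r⁻ d))) (cong (deg M) (rr⁻ d))

  -- The dart z leads from v to y, its successors under r lead to e and to the neighbours of degrees k, 5 and K;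
  -- first z says that y pays, and not e.
  special : Dart M → Bool
  special z = (deg M z ≤ᵇ 5) ∧ (e z ≤ᵇ 5) ∧ (e (r z) ≤ᵇ 5) ∧ (e (r (r (r z))) ≤ᵇ 5)
    ∧ not (gap (r (r (r (r z)))) ∨ gap z ∨ gap (r z) ∨ gap (r (r z)) ∨ gap (r (r (r z))))

  granted : Dart M → ℕ
  granted z = extra (e (r (r z))) (fin (e (r (r z)))) (e (r (r (r (r z))))) when special z

  first : Dart M → Bool
  first z = (12 ≤ᵇ e (r⁻ (r⁻ (o z)))) ∨ gap (r⁻ (r⁻ (o z)))

  -- The payment made along the dart `x` from the payer to v. If the payer is y, the special dart is
  -- `o x`; if it is e, the special dart is the one before, `r⁻ (o x)`.
  donated : Dart M → ℕ
  donated x = granted (o x) when first (o x) + granted (r⁻ (o x)) when not (first (r⁻ (o x)))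

  -- Both ways of finding the special dart from `x` are permutations of the darts, and exactly one
  -- of y and e pays.
  sum-donated : sum donated ≡ sum granted
  sum-donated = begin
    sum donated
      ≡⟨ ∑-distrib-+ (λ x → granted (o x) when first (o x)) _ ⟩
    sum (λ x → granted (o x) when first (o x)) + sum (λ x → granted (r⁻ (o x)) when not (first (r⁻ (o x))))
      ≡⟨ cong₂ _+_ (sum-opp (λ z → granted z when first z))
           (trans (sum-opp (λ z → granted (r⁻ z) when not (first (r⁻ z))))
                  (sum-r⁻ (λ z → granted z when not (first z)))) ⟩
    sum (λ z → granted z when first z) + sum (λ z → granted z when not (first z))
      ≡⟨ ∑-distrib-+ (λ z → granted z when first z) _ ⟨
    sum (λ z → granted z when first z + granted z when not (first z))
      ≡⟨ sum-cong-≗ (λ z → when-split (granted z) (first z)) ⟩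
    sum granted ∎
    where open ≡-Reasoning

  record Special (z : Dart M) : Set where
    field
      deg-z : deg M z ≤ 5
      e-z   : e z ≤ 5
      e-rz  : e (r z) ≤ 5
      gap-r⁴ : gap (r (r (r (r z)))) ≡ false
      gap-z  : gap z ≡ false
      gap-rz : gap (r z) ≡ false

    r⁴z : r (r (r (r z))) ≡ r⁻ z
    r⁴z = trans (sym (r⁻r _)) (cong r⁻ (closed z deg-z))

    gap-r⁻z : gap (r⁻ z) ≡ false
    gap-r⁻z = trans (cong gap (sym r⁴z)) gap-r⁴

  special-elim : ∀ z → special z ≡ true → Special z
  special-elim z h =
    let h₁ , h = ∧-true {deg M z ≤ᵇ 5} h
        h₂ , h = ∧-true {e z ≤ᵇ 5} h
        h₃ , h = ∧-true {e (r z) ≤ᵇ 5} h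
        _  , h = ∧-true {e (r (r (r z))) ≤ᵇ 5} h
        g₁ , g = ∨-false {gap (r (r (r (r z))))} (not-true h)
        g₂ , g = ∨-false {gap z} g
        g₃ , _ = ∨-false {gap (r z)} g
    in record { deg-z = ≤ᵇ-sound h₁ ; e-z = ≤ᵇ-sound h₂ ; e-rz = ≤ᵇ-sound h₃
              ; gap-r⁴ = g₁ ; gap-z = g₂ ; gap-rz = g₃ }

  granted-bound : ∀ z {y b c} →
    (Special z → b ≡ true → c ≡ true × extra (e (r (r z))) (fin (e (r (r z)))) (e (r (r (r (r z))))) ≤ y) →
    granted z when b ≤ y when c
  granted-bound z {y} {b} {c} f = ≤-trans (≤-reflexive (when-∧ _ (special z) b))
    (when-bound {_} {y} {special z ∧ b} {c} λ h →
      let s , hb = ∧-true {special z} h in f (special-elim z s) hb)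

  -- Estimates from the neighbourhood of the payer alone. Around y lie w, e, v, K in the order of
  -- `r`, around e lie k, v, y, w; the dart `x` leads to v.
  payK payk : Dart M → ℕ
  payK x = extra≤K (fin (e (r x)))
    when ((e x ≤ᵇ 5) ∧ (e (r⁻ x) ≤ᵇ 5) ∧ ((12 ≤ᵇ e (r⁻ (r⁻ x))) ∨ gap (r⁻ (r⁻ x))))
  payk x = extra≤k (e (r⁻ x)) (fin (e (r⁻ x)))
    when ((e x ≤ᵇ 5) ∧ (e (r x) ≤ᵇ 5) ∧ (e (r (r x)) ≤ᵇ 11))

  donated-≤ : ∀ x → donated x ≤ payK x + payk x
  donated-≤ x = +-mono-≤ (granted-bound (o x) fromY) (granted-bound (r⁻ (o x)) fromE)
    where
    fromY : Special (o x) → first (o x) ≡ true → _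
    fromY s f = cong₂ _∧_ (≤ᵇ-complete deg-z) (cong₂ _∧_ (≤ᵇ-complete (≤-trans (≤-reflexive b) e-rz)) first′)
              , ≤-trans (extra-≤K (e (r (r (o x)))) (e (r (r (r (r (o x))))))) (≤-reflexive (cong (λ k → extra≤K (fin k)) K))
      where
      open Special s
      first′ : (12 ≤ᵇ e (r⁻ (r⁻ x))) ∨ gap (r⁻ (r⁻ x)) ≡ true
      first′ = subst (λ y → (12 ≤ᵇ e (r⁻ (r⁻ y))) ∨ gap (r⁻ (r⁻ y)) ≡ true) (o-o x) f
      b : e (r⁻ x) ≡ e (r (o x))
      b = trans (cong (λ y → deg M (o (r⁻ y))) (sym (o-o x)))
            (trans (cong (deg M) (triangle (o x) gap-z)) (deg-r _))
      -- The fifth dart at v is the one before `o x`, and the triangle between these two makes the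
      -- K-vertex the neighbour of y that follows v.
      K : e (r (r (r (r (o x))))) ≡ e (r x)
      K = begin
        e (r (r (r (r (o x)))))          ≡⟨ cong e r⁴z ⟩
        e (r⁻ (o x))                     ≡⟨ deg-r⁻ _ ⟨
        deg M (r⁻ (o (r⁻ (o x))))        ≡⟨ cong (deg M) (o-o _) ⟨
        e (o (r⁻ (o (r⁻ (o x)))))        ≡⟨ cong e (triangle (r⁻ (o x)) gap-r⁻z) ⟩
        e (r (o (r (r⁻ (o x)))))         ≡⟨ cong (λ y → e (r (o y))) (rr⁻ (o x)) ⟩
        e (r (o (o x)))                  ≡⟨ cong (λ y → e (r y)) (o-o x) ⟩
        e (r x)                          ∎
        where open ≡-Reasoning
    fromE : Special (r⁻ (o x)) → not (first (r⁻ (o x))) ≡ true → _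
    fromE s f = cong₂ _∧_ (≤ᵇ-complete (≤-trans (≤-reflexive (sym (deg-r⁻ (o x)))) deg-z))
                  (cong₂ _∧_ (≤ᵇ-complete (≤-trans (≤-reflexive y) e-z))
                    (≤ᵇ-complete (≤-trans (≤-reflexive w) (≤-pred (≤ᵇ-false {12} (proj₁ notFirst))))))
              , ≤-trans (extra-≤k (e (r (r z))) (e (r (r (r (r z)))))) (≤-reflexive (cong (λ k → extra≤k k (fin k)) k))
      where
      open Special s
      z v : Dart M
      z = r⁻ (o x)
      v = r⁻ (r⁻ (o z))
      notFirst : (12 ≤ᵇ e v) ≡ false × gap v ≡ false
      notFirst = ∨-false (not-true f)
      rz : r z ≡ o x
      rz = rr⁻ (o x)
      x≡ : o (r z) ≡ x
      x≡ = trans (cong o rz) (o-o x)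
      rx : r x ≡ o (r⁻ (o z))
      rx = trans (cong r (sym x≡)) (sym (triangle z gap-z))
      y : e (r x) ≡ e z
      y = trans (cong e rx) (trans (cong (deg M) (o-o _)) (deg-r⁻ (o z)))
      k : e (r (r z)) ≡ e (r⁻ x)
      k = trans (sym (deg-r _)) (trans (cong (deg M) (sym (triangle (r z) gap-rz))) (cong (λ y → e (r⁻ y)) x≡))
      -- As y does not pay, the other face at the edge ye is a triangle, so its third vertex w is
      -- also a neighbour of e.
      w : e (r (r x)) ≡ e v
      w = begin
        e (r (r x))              ≡⟨ cong (λ y → e (r y)) rx ⟩
        e (r (o (r⁻ (o z))))     ≡⟨ cong (λ y → e (r (o y))) (rr⁻ (r⁻ (o z))) ⟨
        e (r (o (r v)))          ≡⟨ cong e (triangle v (proj₂ notFirst)) ⟨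
        e (o (r⁻ (o v)))         ≡⟨ cong (deg M) (o-o _) ⟩
        deg M (r⁻ (o v))         ≡⟨ deg-r⁻ (o v) ⟩
        e v                      ∎
        where open ≡-Reasoning

  donated-big : ∀ x → 5 < deg M x → donated x ≡ 0
  donated-big x 5<d = n≤0⇒n≡0 (+-mono-≤
    (granted-bound (o x) {0} {first (o x)} {true} λ s _ → contradiction (Special.e-z s)
      (<⇒≱ (<-≤-trans 5<d (≤-reflexive (cong (deg M) (sym (o-o x)))))))
    (granted-bound (r⁻ (o x)) {0} {not (first (r⁻ (o x)))} {true} λ s _ → contradiction (Special.e-rz s)
      (<⇒≱ (<-≤-trans 5<d (≤-reflexive (cong (deg M) (sym (trans (cong o (rr⁻ (o x))) (o-o x)))))))))

-- Charges around a vertex of degree at least 6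

zero-when : ∀ b → 0 when b ≡ 0
zero-when true  = refl
zero-when false = refl

∧-guard : ∀ {b c} n → (n ≡ false → b ≡ c) → b ∧ not n ≡ c ∧ not n
∧-guard {b} {c} true  f with b | c
... | true  | true  = refl
... | true  | false = refl
... | false | true  = refl
... | false | false = refl
∧-guard false f = cong (_∧ true) (f refl)

-- 90 is the total of all jumps in `halfSteps`.
half≤90 : ∀ k → half k ≤ 90
half≤90 k = stepSum-mono halfSteps {_≤ᵇ k} {λ _ → true} (λ c _ → refl)

-- This is `2 · half k ≤ 240 (k - 6) / k` without the division. From degree 24 on, the bound 90
-- gives `24 * 60`; the smaller degrees are checked one by one.
room : ∀ k → 5 < k → k ≢ 7 → 1440 ≤ k * (240 ∸ (half k + half k))
room k 5<k k≢7 with k ≤? 23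
... | no k≰23  = *-mono-≤ (≰⇒> k≰23) (∸-monoʳ-≤ 240 (+-mono-≤ (half≤90 k) (half≤90 k)))
... | yes k≤23 = small k (subst (λ l → check l ≡ true) (Fin.toℕ-fromℕ< (s≤s k≤23))
                   (allFin-elim {24} (check ∘ toℕ) refl (fromℕ< (s≤s k≤23)))) 5<k k≢7
  where
  check : ℕ → Bool
  check l = (l ≤ᵇ 5) ∨ (l ≡ᵇ 7) ∨ (1440 ≤ᵇ l * (240 ∸ (half l + half l)))
  small : ∀ l → check l ≡ true → 5 < l → l ≢ 7 → 1440 ≤ l * (240 ∸ (half l + half l))
  small l h 5<l l≢7 with l ≤ᵇ 5 in l5 | l ≡ᵇ 7 in l7
  ... | true  | _     = contradiction (≤ᵇ-sound {l} l5) (<⇒≱ 5<l)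
  ... | false | true  = contradiction (≡ᵇ⇒≡ l 7 (subst T (sym l7) _)) l≢7
  ... | false | false = ≤ᵇ-sound {1440} h

-- In the following three, B, Bp and Bn say whether a dart, its predecessor and its successor around a vertex
-- lead to a vertex of degree at least 6, and n₀, n₁ whether the faces before and after the dart are not triangles.
passOn : ℕ → Bool → Bool → Bool → ℕ
passOn h B Bn n₁ = h when (B ∧ not Bn ∧ not n₁)

passBack : ℕ → Bool → Bool → Bool → Bool → ℕ
passBack h large B Bn n₁ = h when (Bn ∧ not B ∧ not n₁) + 60 when (large ∧ n₁)

shipped : ℕ → Bool → Bool → Bool → Bool → Bool → ℕ
shipped k B Bp Bn n₀ n₁ =
  (sends k (Bp ∧ not n₀) (Bn ∧ not n₁) + (60 when ((6 ≤ᵇ k) ∧ n₁) + 60 when ((6 ≤ᵇ k) ∧ n₀))) when not B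

sends-half : ∀ k p q → 5 < k → k ≢ 7 → sends k p q ≡ half k + half k + half k when p + half k when q
sends-half k p q 5<k k≢7 with k ≤? 6
... | yes k≤6 with refl ← ≤-antisym k≤6 5<k = sym (cong₂ _+_ (zero-when p) (zero-when q))
... | no  k≰6 with k ≤ᵇ 7 in k7
...   | true  = contradiction (≤-antisym (≤ᵇ-sound {k} k7) (≰⇒> k≰6)) k≢7
...   | false = refl

when-≤ : ∀ x b → x when b ≤ x
when-≤ x true  = ≤-refl
when-≤ x false = z≤n

double-when : ∀ b → 120 when b ≡ 60 when b + 60 when b
double-when true  = refl
double-when false = refl

-- The account of a single dart. `passOn` and `passBack` move halves to the next and to the previous
-- dart; the 60 in `passBack` moves half of the bonus of a corner to its earlier dart, so that both
-- darts at the corner have 60 to ship. What remains to be paid is at most `2 · half k`.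
spoke : ∀ k B Bp Bn n₀ n₁ → 5 < k → k ≢ 7 →
        passOn (half k) B Bn n₁ + passBack (half k) (6 ≤ᵇ k) Bp B n₀ + shipped k B Bp Bn n₀ n₁
        ≤ 120 when n₀ + passOn (half k) Bp B n₀ + passBack (half k) (6 ≤ᵇ k) B Bn n₁ + (half k + half k)
spoke k B Bp Bn n₀ n₁ 5<k k≢7
  rewrite sends-half k (Bp ∧ not n₀) (Bn ∧ not n₁) 5<k k≢7 | ≤ᵇ-complete 5<k | double-when n₀ = go (half k) B
  where
  open ≤-Reasoning
  open +-*-Solver
  U V : ℕ
  U = 60 when n₀
  V = 60 when n₁
  go : ∀ h B → passOn h B Bn n₁ + passBack h true Bp B n₀
               + (h + h + h when (Bp ∧ not n₀) + h when (Bn ∧ not n₁) + (V + U)) when not B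
               ≤ U + U + passOn h Bp B n₀ + passBack h true B Bn n₁ + (h + h)
  -- Towards a vertex of degree at least 6 nothing is shipped, and at most one half leaves on each
  -- side.
  go h true = begin
    h when (not Bn ∧ not n₁) + (h when (not Bp ∧ not n₀) + U) + 0
      ≤⟨ +-monoˡ-≤ 0 (+-mono-≤ (when-≤ h (not Bn ∧ not n₁)) (+-monoˡ-≤ U (when-≤ h (not Bp ∧ not n₀)))) ⟩
    h + (h + U) + 0
      ≡⟨ solve 2 (λ h u → h :+ (h :+ u) :+ con 0 := u :+ (h :+ h)) refl h U ⟩
    U + (h + h)
      ≤⟨ +-monoˡ-≤ (h + h) (≤-trans (m≤m+n U U) (≤-trans (m≤m+n _ _) (m≤m+n _ _))) ⟩
    U + U + passOn h Bp true n₀ + passBack h true true Bn n₁ + (h + h) ∎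
  -- Towards a 5-vertex all that comes in is shipped, and the account is exact.
  go h false = ≤-reflexive (solve 5
    (λ h x y u v → (con 0 :+ u) :+ (h :+ h :+ x :+ y :+ (v :+ u)) := u :+ u :+ x :+ (y :+ v) :+ (h :+ h)) refl
    h (h when (Bp ∧ not n₀)) (h when (Bn ∧ not n₁)) U V)

-- An upper bound for the 1/4 that a 7-vertex takes from its own charge: the faces are ignored.
slackᵇ : Bool → Bool → Bool → ℕ
slackᵇ B Bp Bn = 60 when (not B ∧ (Bp ∨ Bn))

spoke₇ : ∀ B Bp Bn n₀ n₁ →
         passOn 0 B Bn n₁ + passBack 0 true Bp B n₀ + shipped 7 B Bp Bn n₀ n₁
         ≤ 120 when n₀ + passOn 0 Bp B n₀ + passBack 0 true B Bn n₁ + slackᵇ B Bp Bn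
spoke₇ B Bp Bn n₀ n₁ = ≤ᵇ-sound
  {passOn 0 B Bn n₁ + passBack 0 true Bp B n₀ + shipped 7 B Bp Bn n₀ n₁}
  (∀ᵇ-sound check refl (B ∷ Bp ∷ Bn ∷ n₀ ∷ n₁ ∷ []))
  where
  check : Vec Bool 5 → Bool
  check (B ∷ Bp ∷ Bn ∷ n₀ ∷ n₁ ∷ []) =
    passOn 0 B Bn n₁ + passBack 0 true Bp B n₀ + shipped 7 B Bp Bn n₀ n₁
    ≤ᵇ 120 when n₀ + passOn 0 Bp B n₀ + passBack 0 true B Bn n₁ + slackᵇ B Bp Bn

wheel₇ : Vec Bool 7 → ℕ
wheel₇ (a ∷ b ∷ c ∷ d ∷ e ∷ f ∷ g ∷ []) =
  slackᵇ a g b + (slackᵇ b a c + (slackᵇ c b d + (slackᵇ d c e + (slackᵇ e d f + (slackᵇ f e g + (slackᵇ g f a + 0))))))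

-- At most four neighbours of a 7-vertex have degree 5 and follow or precede a neighbour of larger degree.
wheel₇-≤ : ∀ bs → wheel₇ bs ≤ 240
wheel₇-≤ bs = ≤ᵇ-sound (∀ᵇ-sound (λ bs → wheel₇ bs ≤ᵇ 240) refl bs)

-- The discharging

not-false : ∀ {b} → not b ≡ false → b ≡ true
not-false {true} _ = refl

module Discharging (M : RotationSystem) (simple : IsSimple M) (min5 : MinDegreeFive M) where

  open RotationSystem M

  r r⁻ o ψ : Dart M → Dart M
  r = rot M
  r⁻ = rot⁻¹ M
  o = opp M
  ψ = φ M

  e : Dart M → ℕ
  e d = deg M (o d)

  r⁻r : ∀ d → r⁻ (r d) ≡ d
  r⁻r d = inverseˡ σ

  rr⁻ : ∀ d → r (r⁻ d) ≡ d
  rr⁻ d = inverseʳ σ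

  r-injective : ∀ {d x} → r d ≡ r x → d ≡ x
  r-injective {d} {x} eq = trans (sym (r⁻r d)) (trans (cong r⁻ eq) (r⁻r x))

  o-injective : ∀ {d x} → o d ≡ o x → d ≡ x
  o-injective {d} {x} eq = trans (sym (α-invol d)) (trans (cong o eq) (α-invol x))

  ψ-injective : ∀ {d x} → ψ d ≡ ψ x → d ≡ x
  ψ-injective eq = o-injective (r-injective eq)

  module Vertex = Orbits r r-injective
  module Face = Orbits ψ ψ-injective

  deg-r : ∀ d → deg M (r d) ≡ deg M d
  deg-r d = countFin-cong (Vertex.inOrbit-step d)

  deg-r⁻ : ∀ d → deg M (r⁻ d) ≡ deg M d
  deg-r⁻ d = trans (sym (deg-r (r⁻ d))) (cong (deg M) (rr⁻ d))

  deg-closed : ∀ {d k} → deg M d ≡ k → iter r k d ≡ d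
  deg-closed {d} eq = proj₁ (Vertex.orbitSum-count d (λ _ → 0) eq)

  closed : ∀ d → deg M d ≤ 5 → r (r (r (r (r d)))) ≡ d
  closed d d≤5 = deg-closed (≤-antisym d≤5 (min5 d))

  closed⁻ : ∀ d → deg M d ≤ 5 → r⁻ (r⁻ (r⁻ (r⁻ (r⁻ d)))) ≡ d
  closed⁻ d d≤5 = trans (cong (λ x → r⁻ (r⁻ (r⁻ (r⁻ (r⁻ x))))) (sym (closed d d≤5)))
    (trans (cong (λ x → r⁻ (r⁻ (r⁻ (r⁻ x)))) (r⁻r _)) (trans (cong (λ x → r⁻ (r⁻ (r⁻ x))) (r⁻r _))
      (trans (cong (λ x → r⁻ (r⁻ x)) (r⁻r _)) (trans (cong r⁻ (r⁻r _)) (r⁻r d)))))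

  sum-opp : ∀ F → sum (λ d → F (o d)) ≡ sum F
  sum-opp F = sym (sum-permute F α)

  sum-r : ∀ F → sum (λ d → F (r d)) ≡ sum F
  sum-r F = sym (sum-permute F σ)

  sum-r⁻ : ∀ F → sum (λ d → F (r⁻ d)) ≡ sum F
  sum-r⁻ F = sym (sum-permute F (flip σ))

  -- The face of d contains the corner between r⁻ d and d.
  gap : Dart M → Bool
  gap d = not (ψ (ψ (ψ d)) == d)

  gap-intro : ∀ {d} → ψ (ψ (ψ d)) ≡ d → gap d ≡ false
  gap-intro {d} eq = cong not (⌊⌋-true (ψ (ψ (ψ d)) ≟ d) eq)

  gap-elim : ∀ {d} → gap d ≡ false → ψ (ψ (ψ d)) ≡ d
  gap-elim {d} h = ⌊⌋-sound (ψ (ψ (ψ d)) ≟ d) (not-false h)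

  gap-ψ : ∀ d → gap (ψ d) ≡ gap d
  gap-ψ d = cong not (true-iff
    (λ h → ⌊⌋-true (ψ (ψ (ψ d)) ≟ d) (ψ-injective (⌊⌋-sound (ψ (ψ (ψ (ψ d))) ≟ ψ d) h)))
    (λ h → ⌊⌋-true (ψ (ψ (ψ (ψ d))) ≟ ψ d) (cong ψ (⌊⌋-sound (ψ (ψ (ψ d)) ≟ d) h))))

  gap-o : ∀ d → gap (o d) ≡ gap (r d)
  gap-o d = trans (sym (gap-ψ (o d))) (cong (λ x → gap (r x)) (α-invol d))

  triangle : ∀ d → gap (r d) ≡ false → o (r⁻ (o d)) ≡ r (o (r d))
  triangle d h = begin
    o (r⁻ (o d))                        ≡⟨ cong (λ x → o (r⁻ (o x))) returns ⟨
    o (r⁻ (o (o (r (o (r (o (r d))))))))  ≡⟨ cong (λ x → o (r⁻ x)) (α-invol _) ⟩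
    o (r⁻ (r (o (r (o (r d))))))        ≡⟨ cong o (r⁻r _) ⟩
    o (o (r (o (r d))))                 ≡⟨ α-invol _ ⟩
    r (o (r d))                         ∎
    where
    open ≡-Reasoning
    returns : o (r (o (r (o (r d))))) ≡ d
    returns = r-injective (gap-elim h)

  triangle⁻ : ∀ d → gap d ≡ false → o (r (o d)) ≡ r⁻ (o (r⁻ d))
  triangle⁻ d h = begin
    o (r (o d))              ≡⟨ cong (λ x → o (r (o x))) (rr⁻ d) ⟨
    o (r (o (r (r⁻ d))))     ≡⟨ cong o (triangle (r⁻ d) (trans (cong gap (rr⁻ d)) h)) ⟨
    o (o (r⁻ (o (r⁻ d))))    ≡⟨ α-invol _ ⟩
    r⁻ (o (r⁻ d))            ∎
    where open ≡-Reasoning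

  -- The two orientations. Outside `Donations`, `gap d` belongs to the corner between `r⁻ d` and
  -- `d`, hence the shift in the first instance.
  module D⁺ = Donations M r r⁻ rr⁻ r⁻r deg-r closed (λ d → gap (r d)) triangle sum-r⁻ sum-opp
  module D⁻ = Donations M r⁻ r r⁻r rr⁻ deg-r⁻ closed⁻ gap triangle⁻ sum-r sum-opp

  big : Dart M → Bool
  big d = 6 ≤ᵇ e d

  -- All rules are booked on darts: `on` and `back` act between consecutive darts at a vertex,
  -- `sent` across an edge. The 240 in `received` is the share of one dart in the degree; the 6 of
  -- `deg v - 6` appears as 1440 once per vertex.
  on back sent income paid received : Dart M → ℕ
  on d = passOn (half (deg M d)) (big d) (big (r d)) (gap (r d))
  back d = passBack (half (deg M d)) (6 ≤ᵇ deg M d) (big d) (big (r d)) (gap (r d))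
  sent d = shipped (deg M d) (big d) (big (r⁻ d)) (big (r d)) (gap d) (gap (r d))
  income d = 120 when gap d + on (r⁻ d) + back d + (sent (o d) + (D⁺.granted d + D⁻.granted d))
  paid d = on d + back (r⁻ d) + sent d + (D⁺.donated d + D⁻.donated d)

  received d = income d + 240

  sum-+ : ∀ (A B : Dart M → ℕ) → sum (λ d → A d + B d) ≡ sum A + sum B
  sum-+ = ∑-distrib-+

  -- Every other rule only moves charge along a permutation of the darts; the bonus alone comes from
  -- outside, namely from the faces.
  balance : sum income ≡ sum (λ d → 120 when gap d) + sum paid
  balance = begin
    sum income
      ≡⟨ sum-+ (λ d → 120 when gap d + on (r⁻ d) + back d) _ ⟩
    sum (λ d → 120 when gap d + on (r⁻ d) + back d) + sum (λ d → sent (o d) + (D⁺.granted d + D⁻.granted d))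
      ≡⟨ cong₂ _+_
           (trans (sum-+ (λ d → 120 when gap d + on (r⁻ d)) back)
             (cong (_+ sum back) (trans (sum-+ (λ d → 120 when gap d) (λ d → on (r⁻ d))) (cong (G +_) (sum-r⁻ on)))))
           (trans (sum-+ (λ d → sent (o d)) _)
             (cong₂ _+_ (sum-opp sent) (trans (sum-+ D⁺.granted D⁻.granted)
               (cong₂ _+_ (sym D⁺.sum-donated) (sym D⁻.sum-donated))))) ⟩
    G + sum on + sum back + (sum sent + (sum D⁺.donated + sum D⁻.donated))
      ≡⟨ solve 6 (λ c a b s x y → c :+ a :+ b :+ (s :+ (x :+ y)) := c :+ (a :+ b :+ s :+ (x :+ y))) refl
           G (sum on) (sum back) (sum sent) (sum D⁺.donated) (sum D⁻.donated) ⟩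
    G + (sum on + sum back + sum sent + (sum D⁺.donated + sum D⁻.donated))
      ≡⟨ cong (G +_) (sym (trans (sum-+ (λ d → on d + back (r⁻ d) + sent d) _)
           (cong₂ _+_ (trans (sum-+ (λ d → on d + back (r⁻ d)) sent)
             (cong (_+ sum sent) (trans (sum-+ on (λ d → back (r⁻ d))) (cong (sum on +_) (sum-r⁻ back)))))
             (sum-+ D⁺.donated D⁻.donated)))) ⟩
    G + sum paid ∎
    where
    open ≡-Reasoning
    open +-*-Solver
    G : ℕ
    G = sum (λ d → 120 when gap d)

  -- Final charge of the faces

  ψ≢id : ∀ d → ψ d ≢ d
  ψ≢id d eq = contradiction
    (trans (sym (Vertex.inOrbit-sym (Vertex.inOrbit-intro 1 eq))) (proj₁ simple d)) λ ()

  -- In a face of length two, either its two darts form one edge and `r` fixes `d`, against the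
  -- minimum degree, or they belong to two parallel edges.
  ψ²≢id : ∀ d → ψ (ψ d) ≢ d
  ψ²≢id d eq with d ≟ o (ψ d)
  ... | yes d≡ = contradiction fixed moved
    where
    fixed : r d ≡ d
    fixed = trans (cong r d≡) eq
    moved : r d ≢ d
    moved = Vertex.Period.minimal (Vertex.period d) 1 (s≤s z≤n)
      (<-≤-trans (s≤s (s≤s z≤n)) (≤-trans (min5 d) (≤-reflexive (Vertex.count-period d))))
  ... | no d≢ = contradiction
    (trans (sym (subst (λ x → sameVertex M (o d) x ≡ true) (sym (α-invol (ψ d))) (Vertex.inOrbit-intro 1 refl)))
      (proj₂ simple d (o (ψ d)) (Vertex.inOrbit-sym (Vertex.inOrbit-intro 1 eq)) d≢)) λ ()

  -- The charge `2|f| - 6` of a triangle is zero and it gives nothing; a face of length `q ≥ 4` has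
  -- `480 q - 1440 ≥ 120 q`.
  face : ∀ d → Face.orbitSum d (λ x → 120 when gap x) + 1440 ≤ Face.orbitSum d (λ _ → 480)
  face d = go (Face.period d) (Face.count-period d)
    where
    open Face.Period
    open ≤-Reasoning
    go : (P : Face.Period d) → countFin (inOrbit ψ d) ≡ p P →
         Face.orbitSum d (λ x → 120 when gap x) + 1440 ≤ Face.orbitSum d (λ _ → 480)
    go record { pred-p = 0 ; periodic = eq } c = contradiction eq (ψ≢id d)
    go record { pred-p = 1 ; periodic = eq } c = contradiction eq (ψ²≢id d)
    go record { pred-p = 2 ; periodic = eq } c = begin
      Face.orbitSum d (λ x → 120 when gap x) + 1440 ≤⟨ +-monoˡ-≤ 1440 (Face.orbitSum-mono d {B = λ _ → 0} none) ⟩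
      Face.orbitSum d (λ _ → 0) + 1440              ≡⟨ cong (_+ 1440) (Face.orbitSum-const d 0) ⟩
      countFin (inOrbit ψ d) * 0 + 1440             ≡⟨ cong (_+ 1440) (*-zeroʳ (countFin (inOrbit ψ d))) ⟩
      3 * 480                                       ≡⟨ cong (_* 480) {countFin (inOrbit ψ d)} {3} c ⟨
      countFin (inOrbit ψ d) * 480                  ≡⟨ Face.orbitSum-const d 480 ⟨
      Face.orbitSum d (λ _ → 480)                   ∎
      where
      none : ∀ x → inOrbit ψ d x ≡ true → 120 when gap x ≤ 0
      none x h = ≤-reflexive (cong (120 when_) (trans (Face.inOrbit-invariant gap gap-ψ h) (gap-intro eq)))
    go record { pred-p = suc (suc (suc k)) ; periodic = eq } c = begin
      Face.orbitSum d (λ x → 120 when gap x) + 1440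
        ≤⟨ +-monoˡ-≤ 1440 (Face.orbitSum-mono d {B = λ _ → 120} λ x _ → when-≤ 120 (gap x)) ⟩
      Face.orbitSum d (λ _ → 120) + 1440
        ≡⟨ cong (_+ 1440) (Face.orbitSum-const d 120) ⟩
      q * 120 + 1440
        ≤⟨ +-monoʳ-≤ (q * 120) (*-monoˡ-≤ 360 {4} {q} (subst (4 ≤_) (sym c) (m≤m+n 4 k))) ⟩
      q * 120 + q * 360
        ≡⟨ *-distribˡ-+ q 120 360 ⟨
      q * 480
        ≡⟨ Face.orbitSum-const d 480 ⟨
      Face.orbitSum d (λ _ → 480) ∎
      where
      q : ℕ
      q = countFin (inOrbit ψ d)

  -- Final charge of the vertices of degree at least 6

  deg-orbit : ∀ {d x} → sameVertex M d x ≡ true → deg M x ≡ deg M d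
  deg-orbit = Vertex.inOrbit-invariant (deg M) deg-r

  on-r⁻ : ∀ x → on (r⁻ x) ≡ passOn (half (deg M x)) (big (r⁻ x)) (big x) (gap x)
  on-r⁻ x = cong₂ (λ k y → passOn (half k) (big (r⁻ x)) (big y) (gap y)) (deg-r⁻ x) (rr⁻ x)

  back-r⁻ : ∀ x → back (r⁻ x) ≡ passBack (half (deg M x)) (6 ≤ᵇ deg M x) (big (r⁻ x)) (big x) (gap x)
  back-r⁻ x = cong₂ (λ k y → passBack (half k) (6 ≤ᵇ k) (big (r⁻ x)) (big y) (gap y)) (deg-r⁻ x) (rr⁻ x)

  no-donation : ∀ x → 5 < deg M x → paid x ≡ on x + back (r⁻ x) + sent x
  no-donation x 5<d = trans
    (cong₂ (λ a b → on x + back (r⁻ x) + sent x + (a + b)) (D⁺.donated-big x 5<d) (D⁻.donated-big x 5<d))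
    (+-identityʳ _)

  large-spoke : ∀ x → 5 < deg M x → deg M x ≢ 7 → paid x ≤ income x + (half (deg M x) + half (deg M x))
  large-spoke x 5<d d≢7 = begin
    paid x
      ≡⟨ trans (no-donation x 5<d) (cong (λ y → on x + y + sent x) (back-r⁻ x)) ⟩
    _
      ≤⟨ spoke (deg M x) (big x) (big (r⁻ x)) (big (r x)) (gap x) (gap (r x)) 5<d d≢7 ⟩
    _
      ≡⟨ cong (λ y → 120 when gap x + y + back x + (half (deg M x) + half (deg M x))) (on-r⁻ x) ⟨
    120 when gap x + on (r⁻ x) + back x + (half (deg M x) + half (deg M x))
      ≤⟨ +-monoˡ-≤ (half (deg M x) + half (deg M x)) (m≤m+n (120 when gap x + on (r⁻ x) + back x) (sent (o x) + (D⁺.granted x + D⁻.granted x))) ⟩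
    income x + (half (deg M x) + half (deg M x)) ∎
    where open ≤-Reasoning

  -- Of its share of 240 each dart keeps at least `c`, and by `room` these remainders cover 1440.
  large : ∀ d → 5 < deg M d → deg M d ≢ 7 → Vertex.orbitSum d paid + 1440 ≤ Vertex.orbitSum d received
  large d 5<d d≢7 = begin
    Vertex.orbitSum d paid + 1440              ≤⟨ +-monoʳ-≤ (Vertex.orbitSum d paid) (room (deg M d) 5<d d≢7) ⟩
    Vertex.orbitSum d paid + deg M d * c       ≡⟨ cong (Vertex.orbitSum d paid +_) (Vertex.orbitSum-const d c) ⟨
    Vertex.orbitSum d paid + Vertex.orbitSum d (λ _ → c) ≡⟨ Vertex.orbitSum-+ d paid (λ _ → c) ⟨
    Vertex.orbitSum d (λ x → paid x + c)       ≤⟨ Vertex.orbitSum-mono d at ⟩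
    Vertex.orbitSum d received                 ∎
    where
    open ≤-Reasoning
    c h : ℕ
    h = half (deg M d) + half (deg M d)
    c = 240 ∸ h
    at : ∀ x → sameVertex M d x ≡ true → paid x + c ≤ received x
    at x same = begin
      paid x + c           ≤⟨ +-monoˡ-≤ c (subst (λ k → paid x ≤ income x + (half k + half k)) eq
                                (large-spoke x (subst (5 <_) (sym eq) 5<d) (d≢7 ∘ trans (sym eq)))) ⟩
      income x + h + c     ≡⟨ +-assoc (income x) h c ⟩
      income x + (h + c)   ≡⟨ cong (income x +_) (m+[n∸m]≡n
                                (≤-trans (+-mono-≤ (half≤90 (deg M d)) (half≤90 (deg M d))) (≤ᵇ-sound {180} {240} refl))) ⟩
      received x           ∎
      where
      eq : deg M x ≡ deg M d
      eq = deg-orbit same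

  slack : Dart M → ℕ
  slack x = slackᵇ (big x) (big (r⁻ x)) (big (r x))

  seven-spoke : ∀ x → deg M x ≡ 7 → paid x ≤ income x + slack x
  seven-spoke x d≡7 = begin
    paid x
      ≡⟨ trans (no-donation x (≤-trans (≤ᵇ-sound {6} {7} refl) (≤-reflexive (sym d≡7))))
           (trans (cong (λ y → on x + y + sent x) (back-r⁻ x))
             (cong (λ k → passOn (half k) (big x) (big (r x)) (gap (r x))
                          + passBack (half k) (6 ≤ᵇ k) (big (r⁻ x)) (big x) (gap x)
                          + shipped k (big x) (big (r⁻ x)) (big (r x)) (gap x) (gap (r x))) d≡7)) ⟩
    _
      ≤⟨ spoke₇ (big x) (big (r⁻ x)) (big (r x)) (gap x) (gap (r x)) ⟩
    _
      ≡⟨ cong (_+ slack x) (trans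
           (cong (λ k → 120 when gap x + passOn (half k) (big (r⁻ x)) (big x) (gap x)
                        + passBack (half k) (6 ≤ᵇ k) (big x) (big (r x)) (gap (r x))) (sym d≡7))
           (cong (λ y → 120 when gap x + y + back x) (sym (on-r⁻ x)))) ⟩
    120 when gap x + on (r⁻ x) + back x + slack x
      ≤⟨ +-monoˡ-≤ (slack x) (m≤m+n (120 when gap x + on (r⁻ x) + back x) (sent (o x) + (D⁺.granted x + D⁻.granted x))) ⟩
    income x + slack x ∎
    where open ≤-Reasoning

  seven-slack : ∀ d → deg M d ≡ 7 → Vertex.orbitSum d slack ≤ 240
  seven-slack d d≡7 = ≤-trans (≤-reflexive (trans (proj₂ (Vertex.orbitSum-count d slack d≡7)) wheel))
    (wheel₇-≤ (big d ∷ big (iter r 1 d) ∷ big (iter r 2 d) ∷ big (iter r 3 d) ∷ big (iter r 4 d) ∷ big (iter r 5 d) ∷ big (iter r 6 d) ∷ []))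
    where
    r⁻d : r⁻ d ≡ iter r 6 d
    r⁻d = trans (cong r⁻ (sym (deg-closed d≡7))) (r⁻r _)
    step : ∀ i → slack (iter r (suc i) d) ≡ slackᵇ (big (iter r (suc i) d)) (big (iter r i d)) (big (iter r (suc (suc i)) d))
    step i = cong (λ y → slackᵇ (big (iter r (suc i) d)) (big y) (big (iter r (suc (suc i)) d))) (r⁻r _)
    wheel : sum {7} (λ i → slack (iter r (toℕ i) d))
            ≡ wheel₇ (big d ∷ big (iter r 1 d) ∷ big (iter r 2 d) ∷ big (iter r 3 d) ∷ big (iter r 4 d) ∷ big (iter r 5 d) ∷ big (iter r 6 d) ∷ [])
    wheel = cong₂ _+_ (cong (λ y → slackᵇ (big d) (big y) (big (r d))) r⁻d)
      (cong₂ _+_ (step 0) (cong₂ _+_ (step 1) (cong₂ _+_ (step 2) (cong₂ _+_ (step 3) (cong₂ _+_ (step 4)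
        (cong (_+ 0) (trans (step 5) (cong (λ y → slackᵇ (big (iter r 6 d)) (big (iter r 5 d)) (big y)) (deg-closed d≡7)))))))))

  -- A 7-vertex has one unit to spare, `7 * 240 = 240 + 1440`, which pays for at most four
  -- neighbours at 60 each.
  seven : ∀ d → deg M d ≡ 7 → Vertex.orbitSum d paid + 1440 ≤ Vertex.orbitSum d received
  seven d d≡7 = begin
    Vertex.orbitSum d paid + 1440
      ≤⟨ +-monoˡ-≤ 1440 (Vertex.orbitSum-mono d (λ x same → seven-spoke x (trans (deg-orbit same) d≡7))) ⟩
    Vertex.orbitSum d (λ x → income x + slack x) + 1440
      ≡⟨ cong (_+ 1440) (Vertex.orbitSum-+ d income slack) ⟩
    Vertex.orbitSum d income + Vertex.orbitSum d slack + 1440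
      ≤⟨ +-monoˡ-≤ 1440 (+-monoʳ-≤ (Vertex.orbitSum d income) (seven-slack d d≡7)) ⟩
    Vertex.orbitSum d income + 240 + 1440
      ≡⟨ +-assoc (Vertex.orbitSum d income) 240 1440 ⟩
    Vertex.orbitSum d income + 7 * 240
      ≡⟨ cong (λ k → Vertex.orbitSum d income + k * 240) {deg M d} {7} d≡7 ⟨
    Vertex.orbitSum d income + deg M d * 240
      ≡⟨ cong (Vertex.orbitSum d income +_) (Vertex.orbitSum-const d 240) ⟨
    Vertex.orbitSum d income + Vertex.orbitSum d (λ _ → 240)
      ≡⟨ Vertex.orbitSum-+ d income (λ _ → 240) ⟨
    Vertex.orbitSum d received ∎
    where open ≤-Reasoning

  -- Final charge of the 5-vertices

  view : Dart M → Vec ℕ 5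
  view d = e d ∷ e (r d) ∷ e (r (r d)) ∷ e (r (r (r d))) ∷ e (r (r (r (r d)))) ∷ []

  flags : Dart M → Vec Bool 5
  flags d = gap d ∷ gap (r d) ∷ gap (r (r d)) ∷ gap (r (r (r d))) ∷ gap (r (r (r (r d)))) ∷ []

  module Five (d : Dart M) (d≡5 : deg M d ≡ 5) where

    r⁵ : r (r (r (r (r d)))) ≡ d
    r⁵ = deg-closed d≡5

    r⁻¹ : r⁻ d ≡ r (r (r (r d)))
    r⁻¹ = trans (cong r⁻ (sym r⁵)) (r⁻r _)

    r⁻² : r⁻ (r⁻ d) ≡ r (r (r d))
    r⁻² = trans (cong r⁻ r⁻¹) (r⁻r _)

    r⁻³ : r⁻ (r⁻ (r⁻ d)) ≡ r (r d)
    r⁻³ = trans (cong r⁻ r⁻²) (r⁻r _)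

    r⁻⁴ : r⁻ (r⁻ (r⁻ (r⁻ d))) ≡ r d
    r⁻⁴ = trans (cong r⁻ r⁻³) (r⁻r _)

    small : (deg M d ≤ᵇ 5) ≡ true
    small = cong (_≤ᵇ 5) d≡5

    -- Across a triangle, the vertex next to the centre in the rotation of a neighbour is also the
    -- next neighbour of the centre. At other faces the factor `not gap` hides its degree, which is
    -- the purpose of `∧-guard`.
    sent-o : sent (o d) ≡
      sends (e d) (big (r d) ∧ not (gap (r d))) (big (r (r (r (r d)))) ∧ not (gap d))
      + (60 when ((6 ≤ᵇ e d) ∧ gap d) + 60 when ((6 ≤ᵇ e d) ∧ gap (r d)))
    sent-o = assemble
      (cong (6 ≤ᵇ_) (trans (cong (deg M) (α-invol d)) d≡5))
      (trans (cong (λ g → big (r⁻ (o d)) ∧ not g) (gap-o d)) (∧-guard (gap (r d)) λ h →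
        cong (6 ≤ᵇ_) (trans (cong (deg M) (triangle d h)) (deg-r _))))
      (trans (cong (λ g → big (r (o d)) ∧ not g) (gap-ψ d)) (∧-guard (gap d) λ h →
        cong (6 ≤ᵇ_) (trans (cong (deg M) (triangle⁻ d h)) (trans (deg-r⁻ _) (cong e r⁻¹)))))
      (gap-o d) (gap-ψ d)
      where
      assemble : ∀ {b p p′ q q′ n₀ n₀′ n₁ n₁′} → b ≡ false → p ≡ p′ → q ≡ q′ → n₀ ≡ n₀′ → n₁ ≡ n₁′ →
        (sends (e d) p q + (60 when ((6 ≤ᵇ e d) ∧ n₁) + 60 when ((6 ≤ᵇ e d) ∧ n₀))) when not b
        ≡ sends (e d) p′ q′ + (60 when ((6 ≤ᵇ e d) ∧ n₁′) + 60 when ((6 ≤ᵇ e d) ∧ n₀′))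
      assemble refl refl refl refl refl = refl

    grants : Bool → (x₀ x₁ x₂ x₃ x₄ : Dart M) → ℕ
    grants b x₀ x₁ x₂ x₃ x₄ = extra (e x₂) (fin (e x₂)) (e x₄)
      when (b ∧ (e d ≤ᵇ 5) ∧ (e x₁ ≤ᵇ 5) ∧ (e x₃ ≤ᵇ 5) ∧ not (gap x₀ ∨ gap d ∨ gap x₁ ∨ gap x₂ ∨ gap x₃))

    granted⁺ : D⁺.granted d ≡
      extra (e (r (r d))) (fin (e (r (r d)))) (e (r (r (r (r d)))))
        when ((e d ≤ᵇ 5) ∧ (e (r d) ≤ᵇ 5) ∧ (e (r (r (r d))) ≤ᵇ 5)
              ∧ not (gap d ∨ gap (r d) ∨ gap (r (r d)) ∨ gap (r (r (r d))) ∨ gap (r (r (r (r d))))))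
    granted⁺ = cong₂ (λ b x → extra (e (r (r d))) (fin (e (r (r d)))) (e (r (r (r (r d)))))
        when (b ∧ (e d ≤ᵇ 5) ∧ (e (r d) ≤ᵇ 5) ∧ (e (r (r (r d))) ≤ᵇ 5)
              ∧ not (gap x ∨ gap (r d) ∨ gap (r (r d)) ∨ gap (r (r (r d))) ∨ gap (r (r (r (r d)))))))
      small r⁵

    granted⁻ : D⁻.granted d ≡
      extra (e (r (r (r d)))) (fin (e (r (r (r d))))) (e (r d))
        when ((e d ≤ᵇ 5) ∧ (e (r (r (r (r d)))) ≤ᵇ 5) ∧ (e (r (r d)) ≤ᵇ 5)
              ∧ not (gap (r d) ∨ gap d ∨ gap (r (r (r (r d)))) ∨ gap (r (r (r d))) ∨ gap (r (r d))))
    granted⁻ = assemble small r⁻¹ r⁻² r⁻³ r⁻⁴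
      where
      assemble : ∀ {b x₁ x₂ x₃ x₄ y₁ y₂ y₃ y₄} → b ≡ true → x₁ ≡ y₁ → x₂ ≡ y₂ → x₃ ≡ y₃ → x₄ ≡ y₄ →
        grants b x₄ x₁ x₂ x₃ x₄ ≡ grants true y₄ y₁ y₂ y₃ y₄
      assemble refl refl refl refl refl = refl

    gain-≤ : gain (view d) (map fin (view d)) (flags d) ≤ income d
    gain-≤ = begin
      gain (view d) (map fin (view d)) (flags d)
        ≡⟨ cong₂ _+_ (cong (120 when gap d +_) (sym sent-o)) (cong₂ _+_ (sym granted⁺) (sym granted⁻)) ⟩
      120 when gap d + sent (o d) + (D⁺.granted d + D⁻.granted d)
        ≡⟨ +-assoc (120 when gap d) (sent (o d)) _ ⟩
      120 when gap d + (sent (o d) + (D⁺.granted d + D⁻.granted d))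
        ≤⟨ +-monoˡ-≤ _ (≤-trans (m≤m+n (120 when gap d) (on (r⁻ d))) (m≤m+n (120 when gap d + on (r⁻ d)) (back d))) ⟩
      income d ∎
      where open ≤-Reasoning

    loss-≥ : paid d ≤ loss (view d) (map fin (view d)) (flags d)
    loss-≥ = begin
      paid d
        ≡⟨ cong (_+ (D⁺.donated d + D⁻.donated d)) (cong₂ _+_ (cong₂ _+_ no-on no-back) no-sent) ⟩
      D⁺.donated d + D⁻.donated d
        ≤⟨ +-mono-≤ (D⁺.donated-≤ d) (D⁻.donated-≤ d) ⟩
      D⁺.payK d + D⁺.payk d + (D⁻.payK d + D⁻.payk d)
        ≡⟨ assemble r⁻¹ r⁻² (cong r r⁻²) ⟩
      loss (view d) (map fin (view d)) (flags d) ∎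
      where
      open ≤-Reasoning
      no-on : on d ≡ 0
      no-on = trans (cong (λ k → passOn (half k) (big d) (big (r d)) (gap (r d))) d≡5) (zero-when _)
      no-back : back (r⁻ d) ≡ 0
      no-back = trans (cong (λ k → passBack (half k) (6 ≤ᵇ k) (big (r⁻ d)) (big (r (r⁻ d))) (gap (r (r⁻ d))))
        (trans (deg-r⁻ d) d≡5)) (trans (+-identityʳ _) (zero-when _))
      no-sent : sent d ≡ 0
      no-sent = trans (cong (λ k → shipped k (big d) (big (r⁻ d)) (big (r d)) (gap d) (gap (r d))) d≡5) (zero-when _)
      assemble : ∀ {x₁ x₂ x₃ y₁ y₂ y₃} → x₁ ≡ y₁ → x₂ ≡ y₂ → x₃ ≡ y₃ →
        extra≤K (fin (e (r d))) when ((e d ≤ᵇ 5) ∧ (e x₁ ≤ᵇ 5) ∧ ((12 ≤ᵇ e x₂) ∨ gap x₃))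
        + extra≤k (e x₁) (fin (e x₁)) when ((e d ≤ᵇ 5) ∧ (e (r d) ≤ᵇ 5) ∧ (e (r (r d)) ≤ᵇ 11))
        + (extra≤K (fin (e x₁)) when ((e d ≤ᵇ 5) ∧ (e (r d) ≤ᵇ 5) ∧ ((12 ≤ᵇ e (r (r d))) ∨ gap (r (r d))))
           + extra≤k (e (r d)) (fin (e (r d))) when ((e d ≤ᵇ 5) ∧ (e x₁ ≤ᵇ 5) ∧ (e x₂ ≤ᵇ 11)))
        ≡
        extra≤K (fin (e (r d))) when ((e d ≤ᵇ 5) ∧ (e y₁ ≤ᵇ 5) ∧ ((12 ≤ᵇ e y₂) ∨ gap y₃))
        + extra≤k (e y₁) (fin (e y₁)) when ((e d ≤ᵇ 5) ∧ (e (r d) ≤ᵇ 5) ∧ (e (r (r d)) ≤ᵇ 11))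
        + (extra≤K (fin (e y₁)) when ((e d ≤ᵇ 5) ∧ (e (r d) ≤ᵇ 5) ∧ ((12 ≤ᵇ e (r (r d))) ∨ gap (r (r d))))
           + extra≤k (e (r d)) (fin (e (r d))) when ((e d ≤ᵇ 5) ∧ (e y₁ ≤ᵇ 5) ∧ (e y₂ ≤ᵇ 11)))
      assemble refl refl refl = refl

    view-r : view (r d) ≡ rotl (view d)
    view-r = cong (λ x → e (r d) ∷ e (r (r d)) ∷ e (r (r (r d))) ∷ e (r (r (r (r d)))) ∷ e x ∷ []) r⁵

    flags-r : flags (r d) ≡ rotl (flags d)
    flags-r = cong (λ x → gap (r d) ∷ gap (r (r d)) ∷ gap (r (r (r d))) ∷ gap (r (r (r (r d)))) ∷ gap x ∷ []) r⁵

  around-sum : ∀ f k d → deg M d ≡ 5 → around f k (view d) (map fin (view d)) (flags d)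
               ≡ sum {k} (λ i → f (view (iter r (toℕ i) d)) (map fin (view (iter r (toℕ i) d))) (flags (iter r (toℕ i) d)))
  around-sum f zero    d d≡5 = refl
  around-sum f (suc k) d d≡5 = cong (at d +_) (trans
    (cong₂ (λ v m → around f k v (map fin v) m) (sym view-r) (sym flags-r))
    (trans (around-sum f k (r d) (trans (deg-r d) d≡5))
      (sum-cong-≗ {k} λ i → cong at (trans (sym (iter-+ r (toℕ i) 1 d)) (cong (λ j → iter r j d) (+-comm (toℕ i) 1))))))
    where
    open Five d d≡5
    at : Dart M → ℕ
    at x = f (view x) (map fin (view x)) (flags x)

  deg-iter : ∀ k d → deg M (iter r k d) ≡ deg M d
  deg-iter zero    d = refl
  deg-iter (suc k) d = trans (deg-r _) (deg-iter k d)

  -- Absence of the forbidden stars in every position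

  Free : Vec Bound 5 → Set
  Free κ = ∀ d → deg M d ≡ 5 → Avoids (view d) κ

  -- Turning the star back amounts to starting at the preceding dart.
  free-rotl : ∀ {κ} → Free κ → Free (rotl κ)
  free-rotl {κ} free d d≡5 inside = free (r⁻ d) deg≡5
    (unrotate (view (r⁻ d)) κ (subst (λ v → Pointwise _≤ᴮ_ v (rotl κ)) (trans (cong view (sym (rr⁻ d))) view-r) inside))
    where
    deg≡5 : deg M (r⁻ d) ≡ 5
    deg≡5 = trans (deg-r⁻ d) d≡5
    open Five (r⁻ d) deg≡5
    unrotate : ∀ v κ → Pointwise _≤ᴮ_ (rotl v) (rotl κ) → Pointwise _≤ᴮ_ v κ
    unrotate (_ ∷ _ ∷ _ ∷ _ ∷ _ ∷ []) (_ ∷ _ ∷ _ ∷ _ ∷ _ ∷ []) (b ∷ c ∷ d ∷ e ∷ a ∷ []) = a ∷ b ∷ c ∷ d ∷ e ∷ []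

  free-rotations : ∀ k {κ} → Free κ → All Free (rotations k κ)
  free-rotations zero    free = []
  free-rotations (suc k) free = free ∷ free-rotations k (free-rotl free)

  free-star : ∀ κ → ¬ HasStar M κ → Free κ
  free-star (_ ∷ _ ∷ _ ∷ _ ∷ _ ∷ []) none d d≡5 (a₀ ∷ a₁ ∷ a₂ ∷ a₃ ∷ a₄ ∷ []) = none (d , d≡5 , inj₁ λ
    { zero                         → a₀
    ; (suc zero)                   → a₁
    ; (suc (suc zero))             → a₂
    ; (suc (suc (suc zero)))       → a₃
    ; (suc (suc (suc (suc zero)))) → a₄ })

  -- The second alternative of `HasStar` runs through the neighbours by `rot⁻¹`, which from the same
  -- dart is the mirrored order.
  free-mirror : ∀ κ → ¬ HasStar M κ → Free (mirror κ)
  free-mirror (κ₀ ∷ κ₁ ∷ κ₂ ∷ κ₃ ∷ κ₄ ∷ []) none d d≡5 (a₀ ∷ a₄ ∷ a₃ ∷ a₂ ∷ a₁ ∷ []) = none (d , d≡5 , inj₂ λ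
    { zero                         → a₀
    ; (suc zero)                   → subst (λ x → e x ≤ᴮ κ₁) (sym r⁻¹) a₁
    ; (suc (suc zero))             → subst (λ x → e x ≤ᴮ κ₂) (sym r⁻²) a₂
    ; (suc (suc (suc zero)))       → subst (λ x → e x ≤ᴮ κ₃) (sym r⁻³) a₃
    ; (suc (suc (suc (suc zero)))) → subst (λ x → e x ≤ᴮ κ₄) (sym r⁻⁴) a₄ })
    where open Five d d≡5

  free-images : ∀ {κs} → All (λ κ → ¬ HasStar M κ) κs → All Free (images κs)
  free-images none = All.concat⁺ (All.map⁺ (All.map
    (λ {κ} ¬star → All.++⁺ (free-rotations 5 (free-star κ ¬star)) (free-rotations 5 (free-mirror κ ¬star))) none))

  -- Summation over all vertices and faces

  module _ (none : All (λ κ → ¬ HasStar M κ) stars) where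

    balanced : ∀ d → deg M d ≡ 5 → Balanced (view d) (flags d)
    balanced d d≡5 = search-sound (view d) (flags d) 40
      (All.map (λ free → free d d≡5) (free-images none))
      ( (min5 _ ∷ min5 _ ∷ min5 _ ∷ min5 _ ∷ min5 _ ∷ [])
      , (tt ∷ tt ∷ tt ∷ tt ∷ tt ∷ []))
      (∀ᵇ-sound searchAll certificate (flags d))

    five : ∀ d → deg M d ≡ 5 → Vertex.orbitSum d paid + 1440 ≤ Vertex.orbitSum d received
    five d d≡5 = begin
      Vertex.orbitSum d paid + 1440
        ≡⟨ cong (_+ 1440) (proj₂ (Vertex.orbitSum-count d paid d≡5)) ⟩
      sum {5} (λ i → paid (at i)) + 1440
        ≤⟨ +-monoˡ-≤ 1440 (sum-mono λ i → Five.loss-≥ (at i) (at≡5 i)) ⟩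
      sum {5} (λ i → loss (view (at i)) (map fin (view (at i))) (flags (at i))) + 1440
        ≡⟨ cong (_+ 1440) (around-sum loss 5 d d≡5) ⟨
      around loss 5 (view d) (map fin (view d)) (flags d) + 1440
        -- The five darts bring `5 * 240 = 1200` of the required 1440; `Balanced` supplies the other
        -- 240.
        ≡⟨ solve 1 (λ x → x :+ con 1440 := con 240 :+ x :+ con 1200) refl (around loss 5 (view d) (map fin (view d)) (flags d)) ⟩
      240 + around loss 5 (view d) (map fin (view d)) (flags d) + 1200
        ≤⟨ +-monoˡ-≤ 1200 (balanced d d≡5) ⟩
      around gain 5 (view d) (map fin (view d)) (flags d) + 1200
        ≡⟨ cong (_+ 1200) (around-sum gain 5 d d≡5) ⟩
      sum {5} (λ i → gain (view (at i)) (map fin (view (at i))) (flags (at i))) + 1200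
        ≤⟨ +-monoˡ-≤ 1200 (sum-mono λ i → Five.gain-≤ (at i) (at≡5 i)) ⟩
      sum {5} (λ i → income (at i)) + 5 * 240
        ≡⟨ cong₂ (λ x k → x + k * 240) {u = deg M d} {v = 5} (proj₂ (Vertex.orbitSum-count d income d≡5)) d≡5 ⟨
      Vertex.orbitSum d income + deg M d * 240
        ≡⟨ cong (Vertex.orbitSum d income +_) (Vertex.orbitSum-const d 240) ⟨
      Vertex.orbitSum d income + Vertex.orbitSum d (λ _ → 240)
        ≡⟨ Vertex.orbitSum-+ d income (λ _ → 240) ⟨
      Vertex.orbitSum d received ∎
      where
      open ≤-Reasoning
      open +-*-Solver
      at : Fin 5 → Dart M
      at i = iter r (toℕ i) d
      at≡5 : ∀ i → deg M (at i) ≡ 5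
      at≡5 i = trans (deg-iter (toℕ i) d) d≡5

    vertex : ∀ d → Vertex.orbitSum d paid + 1440 ≤ Vertex.orbitSum d received
    vertex d with deg M d ≟ℕ 5 | deg M d ≟ℕ 7
    ... | yes d≡5 | _       = five d d≡5
    ... | no  _   | yes d≡7 = seven d d≡7
    ... | no  d≢5 | no  d≢7 = large d (≤∧≢⇒< (min5 d) (d≢5 ∘ sym)) d≢7

    -- Each dart counts 240 at its vertex and 480 at its face, each vertex and each face costs 1440.
    -- The payments and the bonus occur on both sides and cancel.
    euler-bound : 2 * numVertices M + 2 * numFaces M ≤ n
    euler-bound = *-cancelʳ-≤ (2 * V + 2 * F) n 720 (+-cancelˡ-≤ (G + sum paid) _ _ (begin
      G + sum paid + (2 * V + 2 * F) * 720
        ≡⟨ solve 4 (λ g p v f → g :+ p :+ (con 2 :* v :+ con 2 :* f) :* con 720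
                     := (p :+ v :* con 1440) :+ (g :+ f :* con 1440)) refl G (sum paid) V F ⟩
      sum paid + V * 1440 + (G + F * 1440)
        ≤⟨ +-mono-≤ (Vertex.orbit-bound 1440 received paid vertex)
             (Face.orbit-bound 1440 (λ _ → 480) (λ d → 120 when gap d) face) ⟩
      sum received + sum {n} (λ _ → 480)
        ≡⟨ cong₂ _+_ (trans (sum-+ income (λ _ → 240)) (cong₂ _+_ balance (sum-const n 240))) (sum-const n 480) ⟩
      G + sum paid + n * 240 + n * 480
        ≡⟨ solve 2 (λ x m → x :+ m :* con 240 :+ m :* con 480 := x :+ m :* con 720) refl (G + sum paid) n ⟩
      G + sum paid + n * 720 ∎))
      where
      open ≤-Reasoning
      open +-*-Solver
      V F G : ℕ
      V = numVertices M
      F = numFaces M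
      G = sum (λ d → 120 when gap d)

-- Contradiction with Euler's formula

countFin-positive : ∀ {n} (p : Fin n → Bool) i → p i ≡ true → 0 < countFin p
countFin-positive p zero    pi rewrite pi = s≤s z≤n
countFin-positive p (suc i) pi = ≤-trans (countFin-positive (p ∘ suc) i pi) (m≤n+m _ _)

-- The dart with index 0 represents its component, whatever else it reaches.
numComponents>0 : ∀ M → 0 < RotationSystem.n M → 0 < numComponents M
numComponents>0 M n>0 = countFin-positive (isComponentRep M) (fromℕ< n>0)
  (allFin-intro _ λ x → trans (cong (not (reach M (fromℕ< n>0) (RotationSystem.n M) x) ∨_)
    (⌊⌋-true (_ ≤? toℕ x) (subst (_≤ toℕ x) (sym (Fin.toℕ-fromℕ< n>0)) z≤n))) (Bool.∨-zeroʳ _))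

_≤ᴮ?_ : ∀ k b → Dec (k ≤ᴮ b)
k ≤ᴮ? fin m = k ≤? m
k ≤ᴮ? ∞     = yes tt

-- Decidability allows the existence of a star to be proved by contradiction.
hasStar? : ∀ M κ → Dec (HasStar M κ)
hasStar? M κ = Fin.any? λ d → (deg M d ≟ℕ 5) ×-dec
  (Fin.all? (λ i → _ ≤ᴮ? lookup κ i) ⊎-dec Fin.all? (λ i → _ ≤ᴮ? lookup κ i))

theorem12 : (M : RotationSystem) → IsPlane M → IsSimple M → 0 < RotationSystem.n M → MinDegreeFive M →
    Any (HasStar M)
    ( (fin 5 ∷ fin 5 ∷ fin 5 ∷ fin 7 ∷ fin 17 ∷ [])
    ∷ (fin 7 ∷ fin 5 ∷ fin 5 ∷ fin 7 ∷ fin 11 ∷ [])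
    ∷ (fin 7 ∷ fin 5 ∷ fin 5 ∷ fin 8 ∷ fin 9 ∷ [])
    ∷ (fin 7 ∷ fin 5 ∷ fin 5 ∷ fin 9 ∷ fin 8 ∷ [])
    ∷ (fin 7 ∷ fin 5 ∷ fin 5 ∷ fin 11 ∷ fin 7 ∷ [])
    ∷ (fin 5 ∷ fin 5 ∷ fin 5 ∷ fin 8 ∷ fin 11 ∷ [])
    ∷ (fin 8 ∷ fin 5 ∷ fin 5 ∷ fin 9 ∷ fin 7 ∷ [])
    ∷ (fin 8 ∷ fin 5 ∷ fin 5 ∷ fin 11 ∷ fin 6 ∷ [])
    ∷ (fin 6 ∷ fin 6 ∷ fin 6 ∷ fin 6 ∷ fin 11 ∷ [])
    ∷ (fin 6 ∷ fin 6 ∷ fin 6 ∷ fin 7 ∷ fin 9 ∷ [])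
    ∷ (fin 6 ∷ fin 6 ∷ fin 7 ∷ fin 6 ∷ fin 9 ∷ [])
    ∷ (fin 6 ∷ fin 6 ∷ fin 7 ∷ fin 7 ∷ fin 7 ∷ [])
    ∷ (fin 6 ∷ fin 7 ∷ fin 6 ∷ fin 7 ∷ fin 7 ∷ [])
    ∷ (fin 5 ∷ fin 6 ∷ fin 6 ∷ fin 8 ∷ fin 9 ∷ [])
    ∷ (fin 5 ∷ fin 6 ∷ fin 8 ∷ fin 6 ∷ fin 9 ∷ [])
    ∷ (fin 5 ∷ fin 6 ∷ fin 7 ∷ fin 7 ∷ fin 9 ∷ [])
    ∷ (fin 5 ∷ fin 6 ∷ fin 6 ∷ fin 7 ∷ fin 11 ∷ [])
    ∷ (fin 5 ∷ fin 6 ∷ fin 7 ∷ fin 6 ∷ fin 11 ∷ [])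
    ∷ (fin 5 ∷ fin 7 ∷ fin 6 ∷ fin 7 ∷ fin 9 ∷ [])
    ∷ (fin 5 ∷ fin 7 ∷ fin 7 ∷ fin 6 ∷ fin 9 ∷ [])
    ∷ (fin 5 ∷ fin 6 ∷ fin 6 ∷ fin 6 ∷ fin 17 ∷ [])
    ∷ (fin 5 ∷ fin 7 ∷ fin 6 ∷ fin 6 ∷ fin 11 ∷ [])
    ∷ (fin 5 ∷ fin 8 ∷ fin 6 ∷ fin 6 ∷ fin 10 ∷ [])
    ∷ (fin 5 ∷ fin 9 ∷ fin 6 ∷ fin 6 ∷ fin 9 ∷ [])
    ∷ (fin 5 ∷ fin 5 ∷ fin 9 ∷ fin 6 ∷ fin 9 ∷ [])
    ∷ (fin 5 ∷ fin 6 ∷ fin 6 ∷ fin 5 ∷ ∞ ∷ [])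
    ∷ (fin 5 ∷ fin 6 ∷ fin 7 ∷ fin 5 ∷ fin 23 ∷ [])
    ∷ (fin 5 ∷ fin 6 ∷ fin 8 ∷ fin 5 ∷ fin 15 ∷ [])
    ∷ (fin 5 ∷ fin 6 ∷ fin 9 ∷ fin 5 ∷ fin 14 ∷ [])
    ∷ (fin 5 ∷ fin 9 ∷ fin 5 ∷ fin 6 ∷ fin 10 ∷ [])
    ∷ (fin 5 ∷ fin 8 ∷ fin 5 ∷ fin 6 ∷ fin 11 ∷ [])
    ∷ (fin 5 ∷ fin 7 ∷ fin 5 ∷ fin 6 ∷ fin 17 ∷ [])
    ∷ (fin 5 ∷ fin 7 ∷ fin 7 ∷ fin 5 ∷ fin 11 ∷ [])
    ∷ (fin 5 ∷ fin 7 ∷ fin 8 ∷ fin 5 ∷ fin 9 ∷ [])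
    ∷ (fin 5 ∷ fin 8 ∷ fin 5 ∷ fin 7 ∷ fin 9 ∷ [])
    ∷ (fin 5 ∷ fin 7 ∷ fin 5 ∷ fin 7 ∷ fin 11 ∷ [])
    ∷ (fin 5 ∷ fin 7 ∷ fin 5 ∷ fin 8 ∷ fin 10 ∷ [])
    ∷ (fin 5 ∷ fin 7 ∷ fin 5 ∷ fin 9 ∷ fin 9 ∷ [])
    ∷ (fin 5 ∷ fin 5 ∷ fin 10 ∷ fin 5 ∷ fin 14 ∷ [])
    ∷ (fin 5 ∷ fin 5 ∷ fin 11 ∷ fin 5 ∷ fin 13 ∷ [])
    ∷ [])
theorem12 M plane simple n>0 min5 = decidable-stable (any? (hasStar? M) stars) λ none →
  -- With `c` components, Euler's formula and `euler-bound` give `n + 4 * c ≤ n`, although `c` is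
  -- positive.
  <⇒≱ (m<m+n n (≤-trans (numComponents>0 M n>0) (m≤n*m (numComponents M) 4)))
      (≤-trans (≤-reflexive (sym plane)) (euler-bound (All.¬Any⇒All¬ stars none)))
  where
  open Discharging M simple min5
  open RotationSystem M using (n)
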